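{- There is an absolute constant $c$ such that the following holds. Let $X$ be a semi-permutation, $T$ a partitioning tree for $X$, $U\subseteq V(T)$ a set of vertices such that every root-to-leaf path of $T$ contains exactly one vertex of $U$, and $(X^c,\{X^s_v\}_{v\in U})$ the split of $(X,T)$ at $U$. Then $$\mathrm{WB}(X)\le 4\,\mathrm{WB}(X^c)+8\sum_{v\in U}\mathrm{WB}(X^s_v)+c\,|X|.$$
   Context: Points have integer coordinates; a row (column) is active for $X$ if it contains a point of $X$; $X$ is a semi-permutation if each active row contains exactly one point of $X$. Strong Wilber bound: for a semi-permutation $Z$ with bounding box $B_Z$, let $\mathcal L(Z)$ be the vertical lines with half-integral $x$-coordinate strictly between the minimum and maximum $x$-coordinates of $Z$. For an ordering $\sigma$ of $\mathcal L(Z)$, process lines in order starting from the partition $\{B_Z\}$; each line $L$ splits the current vertical strip $S$ containing it into two, and is charged the number of indices $j$ such that $q_j,q_{j+1}$ lie on opposite sides of $L$, where $q_1,\dots,q_z$ are the points of $Z\cap S$ in increasing $y$-order. $\mathrm{WB}_\sigma(Z)$ is the total charge and $\mathrm{WB}(Z)=\max_\sigma\mathrm{WB}_\sigma(Z)$ ($=0$ if $Z$ has one active column). Partitioning tree for $X$: a rooted binary tree whose vertices $v$ carry closed vertical strips $S(v)$: the root carries the bounding box of $X$; an internal vertex $v$ owns a line $L(v)\in\mathcal L(X)$ strictly inside $S(v)$, and its two children carry the two strips into which $L(v)$ splits $S(v)$; each leaf strip contains exactly one active column of $X$. Split at $U$: for $v\in U$, $X^s_v=X\cap S(v)$; the compressed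 instance $X^c$ replaces, for each $v\in U$, every point $p\in X\cap S(v)$ by $(x_v,p.y)$, where $x_v$ is the $x$-coordinate of the leftmost active column of $X$ in $S(v)$. -}

module Defs where

open import Data.Bool.Base using (Bool; if_then_else_; _xor_)
open import Data.Integer.Base as ℤ using (ℤ; +_; ∣_∣)
import Data.Integer.Properties as ℤ
open import Data.List.Base
  using (List; []; _∷_; [_]; _++_; map; concatMap; filter; find; applyUpTo)
open import Data.List.Extrema ℤ.≤-totalOrder using (min; max)
open import Data.List.Extrema.Nat using () renaming (max to maxℕ)
open import Data.List.Membership.Propositional using (_∈_)
open import Data.List.Membership.Propositional.Properties
  using (∈-∃++; ∈-map⁺; ∈-map⁻; ∈-concatMap⁺; ∈-concatMap⁻)
open import Data.List.Relation.Binary.Permutation.Propositional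
  using (_↭_; ↭-refl; ↭-sym; ↭-trans; prep; swap)
open import Data.List.Relation.Binary.Permutation.Propositional.Properties
  using (∈-resp-↭; drop-mid; ↭-empty-inv)
open import Data.List.Relation.Unary.Any using (Any; here; there)
import Data.List.Relation.Unary.Any as Any
import Data.List.Sort as Sort
open import Data.Maybe.Base using (maybe′)
open import Data.Nat.Base using (ℕ; _+_)
open import Data.Nat.ListAction using (sum)
open import Data.Product.Base using (_×_; _,_; proj₁; proj₂; ∃-syntax)
open import Data.Product using (∃!)
open import Function.Bundles using (_⇔_; mk⇔)
import Relation.Binary.Construct.On as On
open import Relation.Binary.PropositionalEquality.Core using (_≡_; refl)
open import Relation.Nullary.Decidable using (does; _×-dec_)
open import Relation.Unary using (Decidable)

------------------------------------------------------------------------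
-- Points.  A finite set of points is represented by a duplicate-free
-- list, the order of which is irrelevant.

Point : Set
Point = ℤ × ℤ

xc yc : Point → ℤ
xc = proj₁
yc = proj₂

ActiveColumn ActiveRow : List Point → ℤ → Set
ActiveColumn X c = ∃[ p ] (p ∈ X × xc p ≡ c)
ActiveRow    X r = ∃[ p ] (p ∈ X × yc p ≡ r)

IsSemiPermutation : List Point → Set
IsSemiPermutation X =
  ∀ r → ActiveRow X r → ∃! _≡_ (λ p → p ∈ X × yc p ≡ r)

open Sort (On.decTotalOrder ℤ.≤-decTotalOrder yc) public
  using () renaming (sort to sortByRow)

------------------------------------------------------------------------
-- Lines and strips.

-- The integer ℓ stands for the vertical line with x-coordinate ℓ + 1/2.
Line : Set
Line = ℤ

leftOf : Line → Point → Bool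
leftOf ℓ p = does (xc p ℤ.≤? ℓ)

-- A vertical strip is given by the first and the last integral column
-- it contains.  Its sides are sides of the bounding box or half-integral
-- lines, so these two columns determine it.  Vertical extents are
-- omitted: every strip has the full height of the bounding box.
record Strip : Set where
  constructor strip
  field
    lo hi : ℤ

open Strip public

InStrip : Strip → Point → Set
InStrip S p = lo S ℤ.≤ xc p × xc p ℤ.≤ hi S

inStrip? : ∀ S → Decidable (InStrip S)
inStrip? S p = (lo S ℤ.≤? xc p) ×-dec (xc p ℤ.≤? hi S)

infixl 7 _∩_
_∩_ : List Point → Strip → List Point
X ∩ S = filter (inStrip? S) X

-- lo S < ℓ + 1/2 < hi S.  When a side of S is a half-integral line, this
-- still says that the line ℓ lies strictly between the two sides.
StrictlyInside : Strip → Line → Set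
StrictlyInside S ℓ = lo S ℤ.≤ ℓ × ℓ ℤ.< hi S

strictlyInside? : ∀ S → Decidable (StrictlyInside S)
strictlyInside? S ℓ = (lo S ℤ.≤? ℓ) ×-dec (ℓ ℤ.<? hi S)

leftPart rightPart : Strip → Line → Strip
leftPart  S ℓ = strip (lo S) ℓ
rightPart S ℓ = strip (ℤ.suc ℓ) (hi S)

-- The value on [] is a dummy; it has no lines inside.
boundingBox : List Point → Strip
boundingBox []      = strip (+ 0) (+ 0)
boundingBox (p ∷ X) = strip (min (xc p) (map xc X)) (max (xc p) (map xc X))

linesIn : Strip → List Line
linesIn S = applyUpTo (λ i → lo S ℤ.+ + i) ∣ hi S ℤ.- lo S ∣

𝓛 : List Point → List Line
𝓛 Z = linesIn (boundingBox Z)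

------------------------------------------------------------------------
-- Orderings.

module _ {A : Set} where

  insertions : A → List A → List (List A)
  insertions x []       = [ [ x ] ]
  insertions x (y ∷ ys) = (x ∷ y ∷ ys) ∷ map (y ∷_) (insertions x ys)

  permutations : List A → List (List A)
  permutations []       = [ [] ]
  permutations (x ∷ xs) = concatMap (insertions x) (permutations xs)

  private
    insertions-complete : ∀ x as bs → as ++ x ∷ bs ∈ insertions x (as ++ bs)
    insertions-complete x []       []      = here refl
    insertions-complete x []       (_ ∷ _) = here refl
    insertions-complete x (a ∷ as) bs      =
      there (∈-map⁺ (a ∷_) (insertions-complete x as bs))

    insertions-sound : ∀ x ys {σ} → σ ∈ insertions x ys → σ ↭ x ∷ ys
    insertions-sound x []       (here refl) = ↭-refl
    insertions-sound x (y ∷ ys) (here refl) = ↭-refl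
    insertions-sound x (y ∷ ys) (there σ∈) with ∈-map⁻ (y ∷_) σ∈
    ... | τ , τ∈ , refl =
      ↭-trans (prep y (insertions-sound x ys τ∈)) (swap y x ↭-refl)

    complete : ∀ xs {σ} → σ ↭ xs → σ ∈ permutations xs
    complete []       σ↭ with refl ← ↭-empty-inv σ↭ = here refl
    complete (x ∷ xs) σ↭ with ∈-∃++ (∈-resp-↭ (↭-sym σ↭) (here refl))
    ... | as , bs , refl =
      ∈-concatMap⁺ (insertions x)
        (Any.map (λ { refl → insertions-complete x as bs })
          (complete xs (drop-mid as [] σ↭)))

    sound : ∀ xs {σ} → σ ∈ permutations xs → σ ↭ xs
    sound []       (here refl) = ↭-refl
    sound (x ∷ xs) σ∈ = go (sound xs) (∈-concatMap⁻ (insertions x) σ∈)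
      where
      go : ∀ {σ τs} → (∀ {τ} → τ ∈ τs → τ ↭ xs) →
           Any (λ τ → σ ∈ insertions x τ) τs → σ ↭ x ∷ xs
      go f (here σ∈)  = ↭-trans (insertions-sound x _ σ∈) (prep x (f (here refl)))
      go f (there a)  = go (λ τ∈ → f (there τ∈)) a

  ∈-permutations : ∀ {σ xs} → (σ ∈ permutations xs) ⇔ (σ ↭ xs)
  ∈-permutations {xs = xs} = mk⇔ (sound xs) (complete xs)

------------------------------------------------------------------------
-- The strong Wilber bound.

crossings : Line → List Point → ℕ
crossings ℓ []           = 0
crossings ℓ (p ∷ [])     = 0
crossings ℓ (p ∷ q ∷ qs) =
  (if leftOf ℓ p xor leftOf ℓ q then 1 else 0) + crossings ℓ (q ∷ qs)

-- Exactly one strip of a partition contributes to the charge of a line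
-- and is cut by it, namely the one that has the line strictly inside.
chargeIn : List Point → Line → Strip → ℕ
chargeIn Z ℓ S =
  if does (strictlyInside? S ℓ) then crossings ℓ (sortByRow (Z ∩ S)) else 0

charge : List Point → Line → List Strip → ℕ
charge Z ℓ 𝓟 = sum (map (chargeIn Z ℓ) 𝓟)

cut : Line → Strip → List Strip
cut ℓ S = if does (strictlyInside? S ℓ)
          then leftPart S ℓ ∷ rightPart S ℓ ∷ []
          else [ S ]

totalCharge : List Point → List Strip → List Line → ℕ
totalCharge Z 𝓟 []      = 0
totalCharge Z 𝓟 (ℓ ∷ σ) = charge Z ℓ 𝓟 + totalCharge Z (concatMap (cut ℓ) 𝓟) σ

WBσ : List Line → List Point → ℕ
WBσ σ Z = totalCharge Z [ boundingBox Z ] σ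

WB : List Point → ℕ
WB Z = maxℕ 0 (map (λ σ → WBσ σ Z) (permutations (𝓛 Z)))

------------------------------------------------------------------------
-- Partitioning trees.

-- The subtrees whose root carries the strip S.
data Tree (X : List Point) : Strip → Set where
  leaf : ∀ {S} → ∃! _≡_ (ActiveColumn (X ∩ S)) → Tree X S
  node : ∀ {S} (ℓ : Line) → ℓ ∈ 𝓛 X → StrictlyInside S ℓ →
         Tree X (leftPart S ℓ) → Tree X (rightPart S ℓ) → Tree X S

PartitioningTree : List Point → Set
PartitioningTree X = Tree X (boundingBox X)

module _ {X : List Point} where

  data Vertex : ∀ {S} → Tree X S → Set where
    root  : ∀ {S} {t : Tree X S} → Vertex t
    left  : ∀ {S ℓ ℓ∈ in-S l r} → Vertex l → Vertex (node {S = S} ℓ ℓ∈ in-S l r)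
    right : ∀ {S ℓ ℓ∈ in-S l r} → Vertex r → Vertex (node {S = S} ℓ ℓ∈ in-S l r)

  stripOf : ∀ {S} {t : Tree X S} → Vertex t → Strip
  stripOf {S} root  = S
  stripOf (left v)  = stripOf v
  stripOf (right v) = stripOf v

  -- Root-to-leaf paths.
  data Path : ∀ {S} → Tree X S → Set where
    end   : ∀ {S one} → Path (leaf {S = S} one)
    left  : ∀ {S ℓ ℓ∈ in-S l r} → Path l → Path (node {S = S} ℓ ℓ∈ in-S l r)
    right : ∀ {S ℓ ℓ∈ in-S l r} → Path r → Path (node {S = S} ℓ ℓ∈ in-S l r)

  infix 4 _On_
  data _On_ : ∀ {S} {t : Tree X S} → Vertex t → Path t → Set where
    root  : ∀ {S} {t : Tree X S} {π : Path t} → root On π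
    left  : ∀ {S ℓ ℓ∈ in-S l r} {v : Vertex l} {π : Path l} →
            v On π → left {S} {ℓ} {ℓ∈} {in-S} {l} {r} v On left π
    right : ∀ {S ℓ ℓ∈ in-S l r} {v : Vertex r} {π : Path r} →
            v On π → right {S} {ℓ} {ℓ∈} {in-S} {l} {r} v On right π

  MeetsEveryPathOnce : ∀ {S} {t : Tree X S} → List (Vertex t) → Set
  MeetsEveryPathOnce {t = t} U =
    ∀ (π : Path t) → ∃! _≡_ (λ v → v ∈ U × v On π)

  splitInstance : ∀ {S} {t : Tree X S} → Vertex t → List Point
  splitInstance v = X ∩ stripOf v

  leftmostColumn : ∀ {S} {t : Tree X S} → Vertex t → ℤ
  leftmostColumn v = lo (boundingBox (splitInstance v))

  -- When U meets every path once, each point of X lies in the strip of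
  -- exactly one v ∈ U, so neither the order of U nor the default value
  -- for points outside all strips matters.
  compressPoint : ∀ {S} {t : Tree X S} → List (Vertex t) → Point → Point
  compressPoint U p =
    maybe′ (λ v → leftmostColumn v , yc p) p
      (find (λ v → inStrip? (stripOf v) p) U)

  compressed : ∀ {S} {t : Tree X S} → List (Vertex t) → List Point
  compressed U = map (compressPoint U) X

{-# OPTIONS --safe #-}

-- Call a set of points of X lying in one strip of U a block.  A line ordering
-- of X is a binary tree of cuts, and we follow the blocks of a strip S of this
-- tree.  All blocks meeting S lie in S, except possibly the leftmost and the
-- rightmost, which may have been cut before.  A cut ℓ of S is of one of three
-- kinds.
--   * ℓ separates blocks: its charge is the same in X and in the compressed
--     instance.
--   * ℓ cuts an end block: one side of ℓ lies in that block, so the charge is at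
--     most twice the number of points on that side, and this side is from then
--     on a cut of the split instance.
--   * ℓ cuts a block in the middle: up to twice its number of points, the charge
--     is that of the line left of the block in the compressed instance.  The
--     block then becomes an end block on both sides, whereas in the compressed
--     instance it is one column and stays on one side.
-- To repair the last point, S is compared with four strips of the compressed
-- instance, in which each of the two end blocks is kept or dropped.  The
-- sides on which the middle block is kept can be chosen such that the four
-- strips of S account for the four strips of each of its two sides: hence the
-- factor 4.  Each point pays 2 at most twice, when its block is first cut and
-- when it is cut off from the other blocks: hence c = 4.
module Submission where

open import Defs
open import Data.Bool.Base using (Bool; true; false; if_then_else_; _xor_)
open import Data.Integer.Base as ℤ using (ℤ; ∣_∣)
import Data.Integer.Properties as ℤ
open import Algebra.Properties.AbelianGroup ℤ.+-0-abelianGroup using (∙-cancelˡ)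
open import Data.List.Base
  using (List; []; _∷_; [_]; _++_; map; concatMap; filter; find; deduplicate; length)
open import Data.List.Extrema ℤ.≤-totalOrder
  using (max; xs≤max; ⊥≤max; max≤v⁺; min≤xs; min≤⊤; argmin-all)
import Data.List.Extrema.Nat as ℕ
import Data.List.Membership.DecPropositional as DecMembership
open import Data.List.Membership.Propositional using (_∈_; _∉_; lose)
open import Data.List.Membership.Propositional.Properties
  using (∈-filter⁺; ∈-filter⁻; ∈-++⁺ˡ; ∈-++⁺ʳ; ∈-++⁻; ∈-deduplicate⁻; ∈-applyUpTo⁺; ∈-map⁺)
open import Data.List.Membership.Propositional.Properties.WithK using (unique∧set⇒bag)
open import Data.List.Properties using (filter-all; filter-none; map-++; concatMap-++)
open import Data.List.Relation.Binary.BagAndSetEquality using (∼bag⇒↭)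
open import Data.List.Relation.Binary.Permutation.Propositional
  using (_↭_; ↭-sym; ↭-trans; ↭⇒↭ₛ)
import Data.List.Relation.Binary.Permutation.Propositional.Properties as Perm
import Data.List.Relation.Binary.Permutation.Setoid.Properties as PermS
open import Data.List.Relation.Binary.Sublist.Propositional
  using (_⊆_; []; _∷_; _∷ʳ_; ⊆-refl; ⊆-trans; lookup)
open import Data.List.Relation.Binary.Sublist.Propositional.Properties
  using (All-resp-⊆; filter-⊆; filter⁺)
open import Data.List.Relation.Unary.All as All using (All; []; _∷_)
open import Data.List.Relation.Unary.All.Properties as All using (all-filter; ¬Any⇒All¬)
open import Data.List.Relation.Unary.AllPairs as AllPairs using (AllPairs; []; _∷_)
import Data.List.Relation.Unary.AllPairs.Properties as AllPairs
open import Data.List.Relation.Unary.Any as Any using (Any; here; there; any?)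
open import Data.List.Relation.Unary.Sorted.TotalOrder.Properties using (Sorted⇒AllPairs)
open import Data.List.Relation.Unary.Unique.DecPropositional.Properties ℤ._≟_ using (deduplicate-!)
open import Data.List.Relation.Unary.Unique.Propositional using (Unique)
import Data.List.Relation.Unary.Unique.Propositional.Properties as Unique
import Data.List.Sort as Sort
open import Data.Maybe.Base using (just; nothing)
open import Data.Nat.Base as ℕ using (ℕ; _+_; _*_; _≤_; z≤n; s≤s)
open import Data.Nat.ListAction using (sum)
open import Data.Nat.ListAction.Properties using (sum-++)
open import Data.Nat.Properties
  using ( ≤-refl; ≤-reflexive; ≤-trans; <⇒≢; m≤m+n; m≤n+m; m≤n*m; m+n≤o⇒n≤o
        ; +-assoc; +-identityʳ; +-mono-≤; +-monoˡ-≤; +-monoʳ-≤; *-suc; module ≤-Reasoning )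
open import Data.Nat.Tactic.RingSolver using (solve-∀)
open import Data.Product.Base using (_×_; _,_; proj₁; proj₂; ∃-syntax)
open import Data.Sum.Base as Sum using (_⊎_; inj₁; inj₂)
open import Function.Base using (_∘_; const; id; _on_)
open import Function.Bundles using (mk⇔; module Equivalence)
open import Relation.Binary.Bundles using (DecTotalOrder)
import Relation.Binary.Construct.On as On
open import Relation.Binary.PropositionalEquality
  using (_≡_; _≢_; refl; sym; trans; cong; cong₂; subst; subst₂; setoid; module ≡-Reasoning)
open import Relation.Nullary using (¬_; yes; no; does; contradiction)
open import Relation.Nullary.Decidable using (_×-dec_; dec-true; dec-false; ¬?)
open import Relation.Unary using (Decidable)

open DecMembership ℤ._≟_ using (_∈?_; _∉?_)

-- Alternations and cut trees

differ : Bool → Bool → ℕ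
differ b c = if b xor c then 1 else 0

differ-refl : ∀ b → differ b b ≡ 0
differ-refl false = refl
differ-refl true  = refl

differ≤1 : ∀ b c → differ b c ≤ 1
differ≤1 false false = z≤n
differ≤1 false true  = s≤s z≤n
differ≤1 true  false = s≤s z≤n
differ≤1 true  true  = z≤n

differ-triangle : ∀ a b c → differ a c ≤ differ a b + differ b c
differ-triangle false b     false = z≤n
differ-triangle false false true  = s≤s z≤n
differ-triangle false true  true  = s≤s z≤n
differ-triangle true  false false = s≤s z≤n
differ-triangle true  true  false = s≤s z≤n
differ-triangle true  b     true  = z≤n

-- The two sides of a cut may continue with different lines, which an ordering does not express
-- directly. A line may also fail to separate the points that reach it; it then has no alternations.
data Cuts : Set where
  stop  : Cuts
  cutAt : Line → Cuts → Cuts → Cuts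

module _ {A : Set} where

  alternationsFrom : (A → Bool) → Bool → List A → ℕ
  alternationsFrom c b []      = 0
  alternationsFrom c b (p ∷ s) = differ b (c p) + alternationsFrom c (c p) s

  alternations : (A → Bool) → List A → ℕ
  alternations c []      = 0
  alternations c (p ∷ s) = alternationsFrom c (c p) s

  alternationsFrom-change : ∀ c b b′ s →
    alternationsFrom c b s ≤ differ b b′ + alternationsFrom c b′ s
  alternationsFrom-change c b b′ []      = z≤n
  alternationsFrom-change c b b′ (p ∷ s) = begin
    differ b (c p) + r                   ≤⟨ +-monoˡ-≤ r (differ-triangle b b′ (c p)) ⟩
    differ b b′ + differ b′ (c p) + r    ≡⟨ +-assoc (differ b b′) _ r ⟩
    differ b b′ + (differ b′ (c p) + r)  ∎
    where open ≤-Reasoning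
          r = alternationsFrom c (c p) s

  -- Deleting a point replaces the comparisons with its two neighbours by one comparison between
  -- them, which is no larger by the triangle inequality for `differ`.
  alternationsFrom-mono : ∀ c b {s t} → s ⊆ t →
    alternationsFrom c b s ≤ alternationsFrom c b t
  alternationsFrom-mono c b []         = z≤n
  alternationsFrom-mono c b (refl ∷ τ) =
    +-monoʳ-≤ _ (alternationsFrom-mono c _ τ)
  alternationsFrom-mono c b {s} (p ∷ʳ τ) =
    ≤-trans (alternationsFrom-change c b (c p) s)
            (+-monoʳ-≤ _ (alternationsFrom-mono c _ τ))

  alternations-mono : ∀ c {s t} → s ⊆ t → alternations c s ≤ alternations c t
  alternations-mono c []                   = z≤n
  alternations-mono c (refl ∷ τ)           = alternationsFrom-mono c _ τ
  alternations-mono c {[]}    (q ∷ʳ τ)     = z≤n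
  alternations-mono c {p ∷ s} {q ∷ t} (q ∷ʳ τ) = ≤-trans
    (m≤n+m (alternationsFrom c (c p) s) (differ (c q) (c p)))
    (alternationsFrom-mono c (c q) τ)

  alternations-constant : ∀ c b {s} → All (λ p → c p ≡ b) s → alternations c s ≡ 0
  alternations-constant c b []           = refl
  alternations-constant c b (eq ∷ eqs) rewrite eq = go eqs
    where
    go : ∀ {s} → All (λ p → c p ≡ b) s → alternationsFrom c b s ≡ 0
    go []         = refl
    go (eq ∷ eqs) rewrite eq | differ-refl b = go eqs

  weight : (A → ℕ) → List A → ℕ
  weight h s = sum (map h s)

  -- A point takes part in at most two comparisons, so changing its colour is paid for by 2.
  alternations-recolour : ∀ c c′ e {s} →
    (∀ {p} → p ∈ s → c p ≡ c′ p ⊎ 2 ≤ e p) →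
    alternations c s ≤ weight e s + alternations c′ s
  alternations-recolour c c′ e {[]}    _     = z≤n
  alternations-recolour c c′ e {p ∷ s} agree = ≤-trans
    (from (c p) (c′ p) (agree ∘ there))
    (+-monoˡ-≤ _ (+-monoˡ-≤ _ (gap (agree (here refl)))))
    where
    gap : ∀ {p} → c p ≡ c′ p ⊎ 2 ≤ e p → differ (c p) (c′ p) ≤ e p
    gap {p} (inj₁ eq) rewrite eq | differ-refl (c′ p) = z≤n
    gap {p} (inj₂ le) = ≤-trans (differ≤1 (c p) (c′ p)) (≤-trans (s≤s z≤n) le)

    local : ∀ b b′ {p} → c p ≡ c′ p ⊎ 2 ≤ e p →
      differ b (c p) + differ (c p) (c′ p) ≤ differ b b′ + differ b′ (c′ p) + e p
    local b b′ {p} (inj₁ eq) rewrite eq | differ-refl (c′ p) =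
      +-mono-≤ (differ-triangle b b′ (c′ p)) z≤n
    local b b′ {p} (inj₂ le) = ≤-trans
      (+-mono-≤ (differ≤1 b (c p)) (differ≤1 (c p) (c′ p)))
      (≤-trans le (m≤n+m _ _))

    -- Here `b` and `b′` are the old and new colour of the preceding point; `differ b b′` is what
    -- that point still has to pay for its comparison with the next one.
    from : ∀ b b′ {s} → (∀ {p} → p ∈ s → c p ≡ c′ p ⊎ 2 ≤ e p) →
      alternationsFrom c b s ≤ differ b b′ + weight e s + alternationsFrom c′ b′ s
    from b b′ {[]}    agree = z≤n
    from b b′ {p ∷ s} agree = begin
      differ b (c p) + alternationsFrom c (c p) s
        ≤⟨ +-monoʳ-≤ _ (from (c p) (c′ p) (agree ∘ there)) ⟩
      differ b (c p) + (differ (c p) (c′ p) + w + r)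
        ≡⟨ regroup (differ b (c p)) (differ (c p) (c′ p)) w r ⟩
      differ b (c p) + differ (c p) (c′ p) + (w + r)
        ≤⟨ +-monoˡ-≤ _ (local b b′ (agree (here refl))) ⟩
      differ b b′ + differ b′ (c′ p) + e p + (w + r)
        ≡⟨ regroup′ (differ b b′) (differ b′ (c′ p)) (e p) w r ⟩
      differ b b′ + (e p + w) + (differ b′ (c′ p) + r) ∎
      where
      open ≤-Reasoning
      w = weight e s
      r = alternationsFrom c′ (c′ p) s
      regroup : ∀ a b c d → a + (b + c + d) ≡ a + b + (c + d)
      regroup = solve-∀
      regroup′ : ∀ a b c d f → a + b + c + (d + f) ≡ a + (c + d) + (b + f)
      regroup′ = solve-∀

  -- The column function is a parameter, so that one list of points can be cut both by its original
  -- columns and by its contracted ones.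
  isLeft : (A → ℤ) → Line → A → Bool
  isLeft k ℓ p = does (k p ℤ.≤? ℓ)

  below above : (A → ℤ) → Line → List A → List A
  below k ℓ = filter (λ p → k p ℤ.≤? ℓ)
  above k ℓ = filter (λ p → ℓ ℤ.<? k p)

  -- Amortization over one cut: out of its budget `h` a point pays `e` now and keeps `h₁` or `h₂`
  -- for the side on which it lies.
  weight-split : ∀ k ℓ (e h h₁ h₂ : A → ℕ) {s} →
    (∀ {p} → p ∈ s → k p ℤ.≤ ℓ → e p + h₁ p ≤ h p) →
    (∀ {p} → p ∈ s → ℓ ℤ.< k p → e p + h₂ p ≤ h p) →
    weight e s + (weight h₁ (below k ℓ s) + weight h₂ (above k ℓ s)) ≤ weight h s
  weight-split k ℓ e h h₁ h₂ {[]}    _  _  = z≤n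
  weight-split k ℓ e h h₁ h₂ {p ∷ s} lo hi
    with k p ℤ.≤? ℓ | ℓ ℤ.<? k p | weight-split k ℓ e h h₁ h₂ {s} (lo ∘ there) (hi ∘ there)
  ... | yes p≤ | yes p> | _  = contradiction (ℤ.≤-<-trans p≤ p>) (ℤ.<-irrefl refl)
  ... | yes p≤ | no  p≯ | ih = begin
    e p + weight e s + (h₁ p + w₁ + w₂)    ≡⟨ regroup (e p) (weight e s) (h₁ p) w₁ w₂ ⟩
    e p + h₁ p + (weight e s + (w₁ + w₂))  ≤⟨ +-mono-≤ (lo (here refl) p≤) ih ⟩
    h p + weight h s                       ∎
    where
    open ≤-Reasoning
    w₁ = weight h₁ (below k ℓ s)
    w₂ = weight h₂ (above k ℓ s)
    regroup : ∀ a b c d f → a + b + (c + d + f) ≡ a + c + (b + (d + f))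
    regroup = solve-∀
  ... | no  p≰ | yes p> | ih = begin
    e p + weight e s + (w₁ + (h₂ p + w₂))  ≡⟨ regroup (e p) (weight e s) (h₂ p) w₁ w₂ ⟩
    e p + h₂ p + (weight e s + (w₁ + w₂))  ≤⟨ +-mono-≤ (hi (here refl) p>) ih ⟩
    h p + weight h s                       ∎
    where
    open ≤-Reasoning
    w₁ = weight h₁ (below k ℓ s)
    w₂ = weight h₂ (above k ℓ s)
    regroup : ∀ a b c d f → a + b + (d + (c + f)) ≡ a + c + (b + (d + f))
    regroup = solve-∀
  ... | no  p≰ | no  p≯ | _  = contradiction (ℤ.≰⇒> p≰) p≯

  ⊆-filter : ∀ {P : A → Set} (P? : Decidable P) {s t} →
    s ⊆ t → All P s → s ⊆ filter P? t
  ⊆-filter P? s⊆t Ps =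
    subst (_⊆ _) (filter-all P? Ps) (filter⁺ P? P? (λ { refl p → p }) s⊆t)

  -- For a list in row order this is the total charge of the cuts.
  cost : (A → ℤ) → Cuts → List A → ℕ
  cost k stop          s = 0
  cost k (cutAt ℓ t u) s =
    alternations (isLeft k ℓ) s
    + (cost k t (below k ℓ s) + cost k u (above k ℓ s))

  cost-mono : ∀ k t {s s′} → s ⊆ s′ → cost k t s ≤ cost k t s′
  cost-mono k stop          τ = z≤n
  cost-mono k (cutAt ℓ t u) τ = +-mono-≤ (alternations-mono _ τ)
    (+-mono-≤ (cost-mono k t (filter⁺ _ _ (λ { refl p → p }) τ))
              (cost-mono k u (filter⁺ _ _ (λ { refl p → p }) τ)))

  cost-[] : ∀ k t → cost k t [] ≡ 0
  cost-[] k stop = refl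
  cost-[] k (cutAt ℓ t u) = cong₂ _+_ (cost-[] k t) (cost-[] k u)

  -- Glues trees under a common cut. By `cost-mono` the trees may have been built for fewer points
  -- than the cut leaves on each side.
  cost-cutAt : ∀ k ℓ t u {s s₁ s₂} →
    s₁ ⊆ s → All (λ p → k p ℤ.≤ ℓ) s₁ → s₂ ⊆ s → All (λ p → ℓ ℤ.< k p) s₂ →
    alternations (isLeft k ℓ) s + (cost k t s₁ + cost k u s₂)
    ≤ cost k (cutAt ℓ t u) s
  cost-cutAt k ℓ t u {s} τ₁ lo τ₂ hi =
    +-monoʳ-≤ (alternations (isLeft k ℓ) s) (+-mono-≤
      (cost-mono k t (⊆-filter (λ p → k p ℤ.≤? ℓ) τ₁ lo))
      (cost-mono k u (⊆-filter (λ p → ℓ ℤ.<? k p) τ₂ hi)))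

module _ {I : Set} where

  weight-∈ : ∀ (h : I → ℕ) {v V} → v ∈ V → h v ≤ weight h V
  weight-∈ h (here refl) = m≤m+n _ _
  weight-∈ h (there v∈)  = ≤-trans (weight-∈ h v∈) (m≤n+m _ _)

  weight-mono : ∀ {h h′ : I → ℕ} → (∀ v → h v ≤ h′ v) → ∀ V → weight h V ≤ weight h′ V
  weight-mono le []      = z≤n
  weight-mono le (v ∷ V) = +-mono-≤ (le v) (weight-mono le V)

  weight-superadditive : ∀ (h₁ h₂ h : I → ℕ) → (∀ v → h₁ v + h₂ v ≤ h v) →
    ∀ V → weight h₁ V + weight h₂ V ≤ weight h V
  weight-superadditive h₁ h₂ h le []      = z≤n
  weight-superadditive h₁ h₂ h le (v ∷ V) = begin
    h₁ v + w₁ + (h₂ v + w₂)  ≡⟨ regroup (h₁ v) w₁ (h₂ v) w₂ ⟩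
    h₁ v + h₂ v + (w₁ + w₂)  ≤⟨ +-mono-≤ (le v) (weight-superadditive h₁ h₂ h le V) ⟩
    h v + weight h V         ∎
    where
    open ≤-Reasoning
    w₁ = weight h₁ V
    w₂ = weight h₂ V
    regroup : ∀ a b c d → a + b + (c + d) ≡ a + c + (b + d)
    regroup = solve-∀

-- Contracting blocks

module _ {A : Set} {P : A → Set} (P? : Decidable P) where

  -- The amount 2 is what `alternations-recolour` asks of a point that changes colour.
  toll : A → ℕ
  toll p = if does (P? p) then 2 else 0

  toll-yes : ∀ {p} → P p → toll p ≡ 2
  toll-yes {p} Pp rewrite dec-true (P? p) Pp = refl

  toll-no : ∀ {p} → ¬ P p → toll p ≡ 0
  toll-no {p} ¬Pp rewrite dec-false (P? p) ¬Pp = refl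

  toll≤2 : ∀ p → toll p ≤ 2
  toll≤2 p with does (P? p)
  ... | true  = ≤-refl
  ... | false = z≤n

toll-mono : ∀ {A : Set} {P Q : A → Set} (P? : Decidable P) (Q? : Decidable Q) p →
  (P p → Q p) → toll P? p ≤ toll Q? p
toll-mono P? Q? p P⇒Q with P? p
... | yes Pp = ≤-reflexive (sym (toll-yes Q? (P⇒Q Pp)))
... | no  _  = z≤n

-- Here `x` is the original and `g` the contracted column, and the blocks are the fibres of `g` on
-- `s₀`. Monotonicity of `g` orders the blocks from left to right, and `covered` puts each whole
-- block into one split instance.
module Contraction
  {A I : Set} (x g : A → ℤ) (V : List I)
  {Q : I → A → Set} (Q? : ∀ v → Decidable (Q v)) (s₀ : List A)
  (g-mono : ∀ {p q} → p ∈ s₀ → q ∈ s₀ → x p ℤ.≤ x q → g p ℤ.≤ g q)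
  (covered : ∀ {p} → p ∈ s₀ →
             ∃[ v ] (v ∈ V × (∀ {q} → q ∈ s₀ → g q ≡ g p → Q v q)))
  where

  within : ℤ → ℤ → List A → List A
  within a b = filter (λ p → (a ℤ.≤? g p) ×-dec (g p ℤ.≤? b))

  -- The choices true and false keep and drop the end block.
  lower upper : Bool → ℤ → ℤ
  lower true  a = a
  lower false a = ℤ.suc a
  upper true  b = b
  upper false b = ℤ.pred b

  -- The first choice concerns the end block in column `a`, the second the one in column `b`. Each
  -- of the four choices has its own tree, because `splitInside` has to cut them differently.
  Family : Set
  Family = Bool → Bool → Cuts

  part : Family → ℤ → ℤ → List A → Bool → Bool → ℕ
  part D a b s i j = cost g (D i j) (within (lower i a) (upper j b) s)

  total : Family → ℤ → ℤ → List A → ℕ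
  total D a b s = (part D a b s true true + part D a b s true false)
                  + (part D a b s false true + part D a b s false false)

  blockCost : (I → Cuts) → List A → ℕ
  blockCost f s = weight (λ v → cost x (f v) (filter (Q? v) s)) V

  inside? : ∀ a b → Decidable (λ p → a ℤ.< g p × g p ℤ.< b)
  inside? a b p = (a ℤ.<? g p) ×-dec (g p ℤ.<? b)

  -- A point pays 2 when its block is first cut, after which it lies in an end
  -- block, and 2 when it is cut off from the other blocks.
  potential : ℤ → ℤ → A → ℕ
  potential a b p = 2 + toll (inside? a b) p

  total-mono : ∀ D a b {s s′} → s ⊆ s′ → total D a b s ≤ total D a b s′
  total-mono D a b {s} {s′} τ =
    +-mono-≤ (+-mono-≤ (mono true true) (mono true false))
             (+-mono-≤ (mono false true) (mono false false))
    where
    mono : ∀ i j → part D a b s i j ≤ part D a b s′ i j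
    mono i j = cost-mono g (D i j) (filter⁺ _ _ (λ { refl p → p }) τ)

  -- In every split instance `ℓ` is put on top of the two trees; its own charge there is dropped.
  blockCost-cutAt : ∀ ℓ f₁ f₂ s →
    blockCost f₁ (below x ℓ s) + blockCost f₂ (above x ℓ s)
    ≤ blockCost (λ v → cutAt ℓ (f₁ v) (f₂ v)) s
  blockCost-cutAt ℓ f₁ f₂ s = weight-superadditive _ _ _ atBlock V
    where
    atBlock : ∀ v →
      cost x (f₁ v) (filter (Q? v) (below x ℓ s))
      + cost x (f₂ v) (filter (Q? v) (above x ℓ s))
      ≤ cost x (cutAt ℓ (f₁ v) (f₂ v)) (filter (Q? v) s)
    atBlock v = m+n≤o⇒n≤o (alternations (isLeft x ℓ) (filter (Q? v) s))
      (cost-cutAt x ℓ (f₁ v) (f₂ v)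
        (filter⁺ _ _ (λ { refl q → q }) (filter-⊆ left? s)) (All.filter⁺ (Q? v) (all-filter left? s))
        (filter⁺ _ _ (λ { refl q → q }) (filter-⊆ right? s)) (All.filter⁺ (Q? v) (all-filter right? s)))
      where
      left? = λ p → x p ℤ.≤? ℓ
      right? = λ p → ℓ ℤ.<? x p

  -- Some split instance contains the whole block, and its summand alone is the left-hand side.
  blockCost-oneBlock : ∀ t {c s} → s ⊆ s₀ → All (λ p → g p ≡ c) s →
    cost x t s ≤ blockCost (const t) s
  blockCost-oneBlock t {s = []}    τ [] rewrite cost-[] x t = z≤n
  blockCost-oneBlock t {s = p ∷ s} τ (gp ∷ gs) with covered (lookup τ (here refl))
  ... | v , v∈V , inBlock = begin
    cost x t (p ∷ s)                    ≡⟨ cong (cost x t) (filter-all (Q? v) allQ) ⟨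
    cost x t (filter (Q? v) (p ∷ s))    ≤⟨ weight-∈ (λ v → cost x t (filter (Q? v) (p ∷ s))) v∈V ⟩
    blockCost (const t) (p ∷ s)         ∎
    where
    open ≤-Reasoning
    allQ : All (Q v) (p ∷ s)
    allQ = All.tabulate λ {q} q∈ → inBlock (lookup τ q∈)
      (trans (All.lookup (gp ∷ gs) q∈) (sym gp))

  -- The induction invariant. The trees `D` of the compressed instance and `f` of the split
  -- instances are built along with the estimate.
  record Bounded (t : Cuts) (a b : ℤ) (s : List A) : Set where
    field
      D : Family
      f : I → Cuts
      bound : cost x t s ≤ total D a b s + blockCost f s + weight (potential a b) s

  -- The bookkeeping shared by all kinds of cut: of the charge `α`, the points pay `e` and the
  -- compressed instance pays `α′`. Indices 1 and 2 refer to the left and the right side.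
  assemble : ∀ {α w d f c₁ c₂} α′ e w₁ w₂ d₁ d₂ f₁ f₂ →
    α ≤ e + α′ → e + (w₁ + w₂) ≤ w → α′ + (d₁ + d₂) ≤ d → f₁ + f₂ ≤ f →
    c₁ ≤ d₁ + f₁ + w₁ → c₂ ≤ d₂ + f₂ + w₂ → α + (c₁ + c₂) ≤ d + f + w
  assemble {α} {w} {d} {f} {c₁} {c₂} α′ e w₁ w₂ d₁ d₂ f₁ f₂ hα hw hd hf h₁ h₂ = begin
    α + (c₁ + c₂)
      ≤⟨ +-mono-≤ hα (+-mono-≤ h₁ h₂) ⟩
    e + α′ + (d₁ + f₁ + w₁ + (d₂ + f₂ + w₂))
      ≡⟨ regroup e α′ d₁ f₁ w₁ d₂ f₂ w₂ ⟩
    α′ + (d₁ + d₂) + (f₁ + f₂) + (e + (w₁ + w₂))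
      ≤⟨ +-mono-≤ (+-mono-≤ hd hf) hw ⟩
    d + f + w ∎
    where
    open ≤-Reasoning
    regroup : ∀ e α d₁ f₁ w₁ d₂ f₂ w₂ →
      e + α + (d₁ + f₁ + w₁ + (d₂ + f₂ + w₂)) ≡ α + (d₁ + d₂) + (f₁ + f₂) + (e + (w₁ + w₂))
    regroup = solve-∀

  -- The successor of `c` is a separate variable so that the lemma fits both the line right of a
  -- column, by `refl`, and the line left of it, by `ℤ.suc-pred`.
  cost-within-cutAt : ∀ {a b c c′ s s₁ s₂} t u →
    ℤ.suc c ≡ c′ → a ℤ.≤ c′ → c ℤ.≤ b → s₁ ⊆ s → s₂ ⊆ s →
    alternations (isLeft g c) (within a b s)
    + (cost g t (within a c s₁) + cost g u (within c′ b s₂))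
    ≤ cost g (cutAt c t u) (within a b s)
  cost-within-cutAt {a} {b} {c} {c′} {s} {s₁} {s₂} t u refl a≤c′ c≤b τ₁ τ₂ =
    cost-cutAt g c t u
      (filter⁺ _ _ (λ { refl (a≤ , ≤c) → a≤ , ℤ.≤-trans ≤c c≤b }) τ₁)
      (All.map proj₂ (all-filter _ s₁))
      (filter⁺ _ _ (λ { refl (c′≤ , ≤b) → ℤ.≤-trans a≤c′ c′≤ , ≤b }) τ₂)
      (All.map (λ (c′≤ , _) → ℤ.suc[i]≤j⇒i<j c′≤) (all-filter _ s₂))

  within-all : ∀ {a b s} → All (λ p → a ℤ.≤ g p × g p ℤ.≤ b) s → within a b s ≡ s
  within-all = filter-all _

  -- The effect of a single cut

  module _ {a b : ℤ} {s : List A} (ℓ : Line) (t u : Cuts)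
    (s⊆s₀ : s ⊆ s₀) (ends : All (λ p → a ℤ.≤ g p × g p ℤ.≤ b) s)
    where

    private
      s₁ = below x ℓ s
      s₂ = above x ℓ s
      τ₁ : s₁ ⊆ s
      τ₁ = filter-⊆ _ s
      τ₂ : s₂ ⊆ s
      τ₂ = filter-⊆ _ s
      ends₁ = All-resp-⊆ τ₁ ends
      ends₂ = All-resp-⊆ τ₂ ends
      onLeft : A → Bool
      onLeft = isLeft x ℓ
      constant : ∀ b → alternations (const b) s ≡ 0
      constant b = alternations-constant (const b) b (All.universal (λ _ → refl) s)

    -- Each point on the left pays 2 to be recoloured, after which the cut has no alternations.
    -- These points keep no potential: they lie in one block, so the rest of their cost belongs to a
    -- split instance. The family `D` stays that of the right side.
    peelLeft : All (λ p → g p ℤ.≤ a) s₁ → Bounded u a b s₂ → Bounded (cutAt ℓ t u) a b s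
    peelLeft g≤a ih = record
      { D = D
      ; f = λ v → cutAt ℓ t (f v)
      ; bound = assemble
          (alternations (const false) s) (weight e s)
          (weight (const 0) s₁) (weight (potential a b) s₂)
          0 (total D a b s₂) (blockCost (const t) s₁) (blockCost f s₂)
          (alternations-recolour onLeft (const false) e agree)
          (weight-split x ℓ e (potential a b) (const 0) (potential a b) toll-left toll-right)
          (≤-trans (≤-reflexive (cong (_+ total D a b s₂) (constant false))) (total-mono D a b τ₂))
          (blockCost-cutAt ℓ (const t) f s)
          (≤-trans (blockCost-oneBlock t (⊆-trans τ₁ s⊆s₀) one) (m≤m+n _ _))
          bound
      }
      where
      open Bounded ih
      e : A → ℕ
      e = toll (λ p → x p ℤ.≤? ℓ)
      one : All (λ p → g p ≡ a) s₁
      one = All.zipWith (λ (g≤ , ≤g , _) → ℤ.≤-antisym g≤ ≤g) (g≤a , ends₁)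
      agree : ∀ {p} → p ∈ s → onLeft p ≡ false ⊎ 2 ≤ e p
      agree {p} _ with does (x p ℤ.≤? ℓ)
      ... | true  = inj₂ ≤-refl
      ... | false = inj₁ refl
      toll-left : ∀ {p} → p ∈ s → x p ℤ.≤ ℓ → e p + 0 ≤ potential a b p
      toll-left {p} _ x≤ rewrite toll-yes (λ p → x p ℤ.≤? ℓ) x≤ = m≤m+n 2 _
      toll-right : ∀ {p} → p ∈ s → ℓ ℤ.< x p → e p + potential a b p ≤ potential a b p
      toll-right {p} _ x> rewrite toll-no (λ p → x p ℤ.≤? ℓ) (ℤ.<⇒≱ x>) = ≤-refl

    -- The mirror image of `peelLeft`.
    peelRight : All (λ p → b ℤ.≤ g p) s₂ → Bounded t a b s₁ → Bounded (cutAt ℓ t u) a b s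
    peelRight b≤g ih = record
      { D = D
      ; f = λ v → cutAt ℓ (f v) u
      ; bound = assemble
          (alternations (const true) s) (weight e s)
          (weight (potential a b) s₁) (weight (const 0) s₂)
          (total D a b s₁) 0 (blockCost f s₁) (blockCost (const u) s₂)
          (alternations-recolour onLeft (const true) e agree)
          (weight-split x ℓ e (potential a b) (potential a b) (const 0) toll-left toll-right)
          (≤-trans (≤-reflexive (cong₂ _+_ (constant true) (+-identityʳ _)))
                   (total-mono D a b τ₁))
          (blockCost-cutAt ℓ f (const u) s)
          bound
          (≤-trans (blockCost-oneBlock u (⊆-trans τ₂ s⊆s₀) one) (m≤m+n _ _))
      }
      where
      open Bounded ih
      e : A → ℕ
      e = toll (λ p → ℓ ℤ.<? x p)
      one : All (λ p → g p ≡ b) s₂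
      one = All.zipWith (λ (≤g , _ , g≤) → ℤ.≤-antisym g≤ ≤g) (b≤g , ends₂)
      agree : ∀ {p} → p ∈ s → onLeft p ≡ true ⊎ 2 ≤ e p
      agree {p} _ with x p ℤ.≤? ℓ
      ... | yes _  = inj₁ refl
      ... | no  x≰ rewrite toll-yes (λ p → ℓ ℤ.<? x p) (ℤ.≰⇒> x≰) = inj₂ ≤-refl
      toll-left : ∀ {p} → p ∈ s → x p ℤ.≤ ℓ → e p + potential a b p ≤ potential a b p
      toll-left {p} _ x≤ rewrite toll-no (λ p → ℓ ℤ.<? x p) (ℤ.≤⇒≯ x≤) = ≤-refl
      toll-right : ∀ {p} → p ∈ s → ℓ ℤ.< x p → e p + 0 ≤ potential a b p
      toll-right {p} _ x> rewrite toll-yes (λ p → ℓ ℤ.<? x p) x> = m≤m+n 2 _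

    -- The lines `ℓ` and `c` induce the same colouring, so no point pays. All four trees are cut at
    -- `c`; the charge is taken from the part that keeps both end blocks, since this part is all of
    -- `s`.
    splitBetween : ∀ {c} → All (λ p → g p ℤ.≤ c) s₁ → All (λ p → c ℤ.< g p) s₂ →
      Bounded t a b s₁ → Bounded u a b s₂ → Bounded (cutAt ℓ t u) a b s
    splitBetween {c} g≤c c<g ih₁ ih₂ = record
      { D = D
      ; f = λ v → cutAt ℓ (B₁.f v) (B₂.f v)
      ; bound = assemble
          (alternations onLeft′ s) (weight (const 0) s)
          (weight (potential a b) s₁) (weight (potential a b) s₂)
          (total B₁.D a b s₁) (total B₂.D a b s₂) (blockCost B₁.f s₁) (blockCost B₂.f s₂)
          (alternations-recolour onLeft onLeft′ (const 0) agree)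
          (weight-split x ℓ (const 0) (potential a b) (potential a b) (potential a b) {s}
            (λ _ _ → ≤-refl) (λ _ _ → ≤-refl))
          totals
          (blockCost-cutAt ℓ B₁.f B₂.f s)
          B₁.bound
          B₂.bound
      }
      where
      module B₁ = Bounded ih₁
      module B₂ = Bounded ih₂
      onLeft′ : A → Bool
      onLeft′ = isLeft g c
      D : Family
      D i j = cutAt c (B₁.D i j) (B₂.D i j)
      agree : ∀ {p} → p ∈ s → onLeft p ≡ onLeft′ p ⊎ 2 ≤ 0
      agree {p} p∈ with x p ℤ.≤? ℓ
      ... | yes x≤ = inj₁ (sym (dec-true (g p ℤ.≤? c) (All.lookup g≤c (∈-filter⁺ _ p∈ x≤))))
      ... | no  x≰ = inj₁ (sym (dec-false (g p ℤ.≤? c)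
              (ℤ.<⇒≱ (All.lookup c<g (∈-filter⁺ _ p∈ (ℤ.≰⇒> x≰))))))
      parts : ∀ i j →
        alternations onLeft′ (within (lower i a) (upper j b) s)
        + (part B₁.D a b s₁ i j + part B₂.D a b s₂ i j) ≤ part D a b s i j
      parts i j = cost-cutAt g c (B₁.D i j) (B₂.D i j)
        (filter⁺ _ _ (λ { refl p → p }) τ₁) (All.filter⁺ _ g≤c)
        (filter⁺ _ _ (λ { refl p → p }) τ₂) (All.filter⁺ _ c<g)
      partsOnly : ∀ i j → part B₁.D a b s₁ i j + part B₂.D a b s₂ i j ≤ part D a b s i j
      partsOnly i j = m+n≤o⇒n≤o (alternations onLeft′ (within (lower i a) (upper j b) s)) (parts i j)
      totals : alternations onLeft′ s + (total B₁.D a b s₁ + total B₂.D a b s₂) ≤ total D a b s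
      totals = begin
        alternations onLeft′ s + (total B₁.D a b s₁ + total B₂.D a b s₂)
          ≡⟨ regroup (alternations onLeft′ s)
               (part B₁.D a b s₁ true true) (part B₁.D a b s₁ true false)
               (part B₁.D a b s₁ false true) (part B₁.D a b s₁ false false)
               (part B₂.D a b s₂ true true) (part B₂.D a b s₂ true false)
               (part B₂.D a b s₂ false true) (part B₂.D a b s₂ false false) ⟩
        _ ≤⟨ +-mono-≤
               (+-mono-≤
                 (subst (λ r → alternations onLeft′ r
                               + (part B₁.D a b s₁ true true + part B₂.D a b s₂ true true)
                               ≤ part D a b s true true)
                        (within-all ends) (parts true true))
                 (partsOnly true false))
               (+-mono-≤ (partsOnly false true) (partsOnly false false)) ⟩
        total D a b s ∎
        where
        open ≤-Reasoning
        regroup : ∀ α a b c d a′ b′ c′ d′ →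
          α + ((a + b + (c + d)) + (a′ + b′ + (c′ + d′)))
          ≡ α + (a + a′) + (b + b′) + ((c + c′) + (d + d′))
        regroup = solve-∀

    -- Column `c` becomes an end column on both sides, so its points leave `inside?`. The 2 that
    -- each of them releases pays for recolouring the block as if the cut passed to its left.
    splitInside : ∀ {c} → a ℤ.< c → c ℤ.< b →
      All (λ p → g p ℤ.≤ c) s₁ → All (λ p → c ℤ.≤ g p) s₂ →
      Bounded t a c s₁ → Bounded u c b s₂ → Bounded (cutAt ℓ t u) a b s
    splitInside {c} a<c c<b g≤c c≤g ih₁ ih₂ = record
      { D = D
      ; f = λ v → cutAt ℓ (B₁.f v) (B₂.f v)
      ; bound = assemble
          (alternations onLeft′ s) (weight e s)
          (weight (potential a c) s₁) (weight (potential c b) s₂)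
          (total B₁.D a c s₁) (total B₂.D c b s₂) (blockCost B₁.f s₁) (blockCost B₂.f s₂)
          (alternations-recolour onLeft onLeft′ e agree)
          (weight-split x ℓ e (potential a b) (potential a c) (potential c b) toll-left toll-right)
          totals
          (blockCost-cutAt ℓ B₁.f B₂.f s)
          B₁.bound
          B₂.bound
      }
      where
      module B₁ = Bounded ih₁
      module B₂ = Bounded ih₂
      onLeft′ : A → Bool
      onLeft′ = isLeft g (ℤ.pred c)
      -- The part of the split block on either side of ℓ becomes an end block of
      -- that side.  Contracted, the block is one column, so each of the four
      -- families can keep it on one side only; with this choice the eight parts
      -- of the two sides are used exactly once.
      D : Family
      D true  true  = cutAt (ℤ.pred c) (B₁.D true  false) (B₂.D true  true)
      D true  false = cutAt c          (B₁.D true  true)  (B₂.D false false)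
      D false true  = cutAt c          (B₁.D false true)  (B₂.D false true)
      D false false = cutAt (ℤ.pred c) (B₁.D false false) (B₂.D true  false)
      inBlock? : Decidable (λ p → g p ≡ c)
      inBlock? p = g p ℤ.≟ c
      e : A → ℕ
      e = toll inBlock?
      agree : ∀ {p} → p ∈ s → onLeft p ≡ onLeft′ p ⊎ 2 ≤ e p
      agree {p} p∈ with g p ℤ.≟ c | x p ℤ.≤? ℓ
      ... | yes _  | _      = inj₂ ≤-refl
      ... | no  g≢ | yes x≤ = inj₁ (sym (dec-true (g p ℤ.≤? ℤ.pred c)
              (ℤ.i<j⇒i≤pred[j] (ℤ.≤∧≢⇒< (All.lookup g≤c (∈-filter⁺ _ p∈ x≤)) g≢))))
      ... | no  g≢ | no  x≰ = inj₁ (sym (dec-false (g p ℤ.≤? ℤ.pred c)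
              (λ g≤ → ℤ.<⇒≱ (ℤ.i≤pred[j]⇒i<j g≤) (All.lookup c≤g (∈-filter⁺ _ p∈ (ℤ.≰⇒> x≰))))))
      toll-left : ∀ {p} → p ∈ s → x p ℤ.≤ ℓ → e p + potential a c p ≤ potential a b p
      toll-left {p} p∈ x≤ with g p ℤ.≟ c
      ... | yes refl
        rewrite toll-yes (inside? a b) {p} (a<c , c<b)
              | toll-no (inside? a c) {p} (ℤ.<-irrefl refl ∘ proj₂) = ≤-refl
      ... | no  _    = +-monoʳ-≤ 2 (toll-mono (inside? a c) (inside? a b) p
              λ (a< , <c) → a< , ℤ.<-trans <c c<b)
      toll-right : ∀ {p} → p ∈ s → ℓ ℤ.< x p → e p + potential c b p ≤ potential a b p
      toll-right {p} p∈ x> with g p ℤ.≟ c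
      ... | yes refl
        rewrite toll-yes (inside? a b) {p} (a<c , c<b)
              | toll-no (inside? c b) {p} (ℤ.<-irrefl refl ∘ proj₁) = ≤-refl
      ... | no  _    = +-monoʳ-≤ 2 (toll-mono (inside? c b) (inside? a b) p
              λ (c< , <b) → ℤ.<-trans a<c c< , <b)
      lower≤c : ∀ i → lower i a ℤ.≤ c
      lower≤c true  = ℤ.<⇒≤ a<c
      lower≤c false = ℤ.i<j⇒suc[i]≤j a<c
      c≤upper : ∀ j → c ℤ.≤ upper j b
      c≤upper true  = ℤ.<⇒≤ c<b
      c≤upper false = ℤ.i<j⇒i≤pred[j] c<b
      blockRight : ∀ i j →
        alternations onLeft′ (within (lower i a) (upper j b) s)
        + (part B₁.D a c s₁ i false + part B₂.D c b s₂ true j)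
        ≤ cost g (cutAt (ℤ.pred c) (B₁.D i false) (B₂.D true j)) (within (lower i a) (upper j b) s)
      blockRight i j = cost-within-cutAt {a = lower i a} {b = upper j b} (B₁.D i false) (B₂.D true j)
        (ℤ.suc-pred c) (lower≤c i) (ℤ.i≤j⇒pred[i]≤j (c≤upper j)) τ₁ τ₂
      blockLeft : ∀ i j →
        alternations (isLeft g c) (within (lower i a) (upper j b) s)
        + (part B₁.D a c s₁ i true + part B₂.D c b s₂ false j)
        ≤ cost g (cutAt c (B₁.D i true) (B₂.D false j)) (within (lower i a) (upper j b) s)
      blockLeft i j = cost-within-cutAt {a = lower i a} {b = upper j b} (B₁.D i true) (B₂.D false j)
        refl (ℤ.≤-trans (lower≤c i) (ℤ.i≤suc[i] c)) (c≤upper j) τ₁ τ₂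
      -- The part `true true` is all of `s`, and its tree cuts at `ℤ.pred c`, the line of `onLeft′`;
      -- so it provides the charge. The other three cuts only contribute their two sides.
      totals : alternations onLeft′ s + (total B₁.D a c s₁ + total B₂.D c b s₂) ≤ total D a b s
      totals = begin
        alternations onLeft′ s + (total B₁.D a c s₁ + total B₂.D c b s₂)
          ≡⟨ regroup (alternations onLeft′ s)
               (part B₁.D a c s₁ true true) (part B₁.D a c s₁ true false)
               (part B₁.D a c s₁ false true) (part B₁.D a c s₁ false false)
               (part B₂.D c b s₂ true true) (part B₂.D c b s₂ true false)
               (part B₂.D c b s₂ false true) (part B₂.D c b s₂ false false) ⟩
        _ ≤⟨ +-mono-≤
               (+-mono-≤
                 (subst (λ r → alternations onLeft′ r
                               + (part B₁.D a c s₁ true false + part B₂.D c b s₂ true true)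
                               ≤ part D a b s true true)
                        (within-all ends) (blockRight true true))
                 (m+n≤o⇒n≤o (alternations _ (within _ _ s)) (blockLeft true false)))
               (+-mono-≤
                 (m+n≤o⇒n≤o (alternations _ (within _ _ s)) (blockLeft false true))
                 (m+n≤o⇒n≤o (alternations _ (within _ _ s)) (blockRight false false))) ⟩
        total D a b s ∎
        where
        open ≤-Reasoning
        regroup : ∀ α a b c d a′ b′ c′ d′ →
          α + ((a + b + (c + d)) + (a′ + b′ + (c′ + d′)))
          ≡ α + (b + a′) + (a + d′) + ((c + c′) + (d + b′))
        regroup = solve-∀

  -- Induction on the tree. With `c` the last block on the left, monotonicity of `g` puts the right
  -- side at or beyond `c`. If `c` is an end, one side lies in an end block; otherwise `ℓ` cuts
  -- block `c` exactly when `c` also occurs on the right.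
  bounded : ∀ t {a b s} → s ⊆ s₀ → All (λ p → a ℤ.≤ g p × g p ℤ.≤ b) s → Bounded t a b s
  bounded stop          τ ends = record { D = λ _ _ → stop ; f = λ _ → stop ; bound = z≤n }
  bounded (cutAt ℓ t u) {a} {b} {s} τ ends = step
    where
    s₁ = below x ℓ s
    s₂ = above x ℓ s
    τ₁ = ⊆-trans (filter-⊆ (λ p → x p ℤ.≤? ℓ) s) τ
    τ₂ = ⊆-trans (filter-⊆ (λ p → ℓ ℤ.<? x p) s) τ
    ends₁ = All.filter⁺ (λ p → x p ℤ.≤? ℓ) ends
    ends₂ = All.filter⁺ (λ p → ℓ ℤ.<? x p) ends
    -- If no point lies on the left, `c` is the default `ℤ.pred a`, which is below all columns of
    -- `s`, and the case `peelLeft` applies.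
    c = max (ℤ.pred a) (map g s₁)
    g≤c : All (λ p → g p ℤ.≤ c) s₁
    g≤c = All.map⁻ (xs≤max (ℤ.pred a) (map g s₁))
    c≤g : All (λ p → c ℤ.≤ g p) s₂
    c≤g = All.tabulate λ {q} q∈ → max≤v⁺
      (ℤ.i≤j⇒pred[i]≤j (proj₁ (All.lookup ends₂ q∈)))
      (All.map⁺ (All.tabulate λ {p} p∈ → g-mono (lookup τ₁ p∈) (lookup τ₂ q∈)
        (ℤ.<⇒≤ (ℤ.≤-<-trans (All.lookup (all-filter _ s) p∈) (All.lookup (all-filter _ s) q∈)))))
    step : Bounded (cutAt ℓ t u) a b s
    step with c ℤ.≤? a | b ℤ.≤? c | any? (λ p → g p ℤ.≟ c) s₂
    ... | yes c≤a | _       | _       =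
      peelLeft ℓ t u τ ends (All.map (λ g≤ → ℤ.≤-trans g≤ c≤a) g≤c) (bounded u τ₂ ends₂)
    ... | no  _   | yes b≤c | _       =
      peelRight ℓ t u τ ends (All.map (ℤ.≤-trans b≤c) c≤g) (bounded t τ₁ ends₁)
    ... | no  a<c | no  c<b | yes _   =
      splitInside ℓ t u τ ends (ℤ.≰⇒> a<c) (ℤ.≰⇒> c<b) g≤c c≤g
        (bounded t τ₁ (All.zipWith (λ ((a≤ , _) , ≤c) → a≤ , ≤c) (ends₁ , g≤c)))
        (bounded u τ₂ (All.zipWith (λ ((_ , ≤b) , c≤) → c≤ , ≤b) (ends₂ , c≤g)))
    ... | no  _   | no  _   | no  ¬c  =
      splitBetween ℓ t u τ ends g≤c
        (All.zipWith (λ (c≤ , g≢) → ℤ.≤∧≢⇒< c≤ (g≢ ∘ sym)) (c≤g , ¬Any⇒All¬ s₂ ¬c))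
        (bounded t τ₁ ends₁) (bounded u τ₂ ends₂)

-- The strong Wilber bound as a maximum over cut trees

-- An ordering as a tree: both sides receive all remaining lines, and a line does nothing on a side
-- that it misses.
sequential : List Line → Cuts
sequential []      = stop
sequential (ℓ ∷ σ) = cutAt ℓ (sequential σ) (sequential σ)

-- In the left strip of ℓ only the lines of t that are not right of ℓ matter,
-- and these do nothing in the right strip.
linesOf : Cuts → List Line
linesOf stop          = []
linesOf (cutAt ℓ t u) = ℓ ∷ filter (ℤ._≤? ℓ) (linesOf t) ++ linesOf u

module _ {A : Set} (k : A → ℤ) where

  Misses : Line → List A → Set
  Misses ℓ s = All (λ p → k p ℤ.≤ ℓ) s ⊎ All (λ p → ℓ ℤ.< k p) s

  misses-⊆ : ∀ {ℓ s s′} → s ⊆ s′ → Misses ℓ s′ → Misses ℓ s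
  misses-⊆ τ = Sum.map (All-resp-⊆ τ) (All-resp-⊆ τ)

  cost-misses : ∀ {ℓ s} t → Misses ℓ s → cost k (cutAt ℓ t t) s ≡ cost k t s
  cost-misses {ℓ} {s} t (inj₁ ≤ℓ)
    rewrite alternations-constant (isLeft k ℓ) true (All.map (λ {p} → dec-true (k p ℤ.≤? ℓ)) ≤ℓ)
          | filter-all (λ p → k p ℤ.≤? ℓ) ≤ℓ
          | filter-none (λ p → ℓ ℤ.<? k p) (All.map ℤ.≤⇒≯ ≤ℓ)
          | cost-[] k t = +-identityʳ _
  cost-misses {ℓ} {s} t (inj₂ ℓ<)
    rewrite alternations-constant (isLeft k ℓ) false
              (All.map (λ {p} ℓ<p → dec-false (k p ℤ.≤? ℓ) (ℤ.<⇒≱ ℓ<p)) ℓ<)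
          | filter-none (λ p → k p ℤ.≤? ℓ) (All.map ℤ.<⇒≱ ℓ<)
          | filter-all (λ p → ℓ ℤ.<? k p) ℓ<
          | cost-[] k t = refl

  cost-filter : ∀ {P : Line → Set} (P? : Decidable P) σ {s} →
    (∀ {ℓ} → ¬ P ℓ → Misses ℓ s) →
    cost k (sequential (filter P? σ)) s ≡ cost k (sequential σ) s
  cost-filter P? []      misses = refl
  cost-filter P? (ℓ ∷ σ) {s} misses with P? ℓ
  ... | yes _  = cong (alternations (isLeft k ℓ) s +_) (cong₂ _+_
          (cost-filter P? σ (misses-⊆ (filter-⊆ _ s) ∘ misses))
          (cost-filter P? σ (misses-⊆ (filter-⊆ _ s) ∘ misses)))
  ... | no ¬Pℓ = trans (cost-filter P? σ misses)
                       (sym (cost-misses (sequential σ) (misses ¬Pℓ)))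

  cost-prefix : ∀ σ τ s → cost k (sequential σ) s ≤ cost k (sequential (σ ++ τ)) s
  cost-prefix []      τ s = z≤n
  cost-prefix (ℓ ∷ σ) τ s = +-monoʳ-≤ (alternations _ s)
    (+-mono-≤ (cost-prefix σ τ (below k ℓ s)) (cost-prefix σ τ (above k ℓ s)))

  cost-skip : ∀ {σ s} τ → All (λ ℓ → Misses ℓ s) σ →
    cost k (sequential (σ ++ τ)) s ≡ cost k (sequential τ) s
  cost-skip τ []       = refl
  cost-skip {_ ∷ σ} τ (m ∷ ms) = trans (cost-misses (sequential (σ ++ τ)) m) (cost-skip {σ} τ ms)

  -- On the left, the filter removes only lines that miss the points, and the lines of `u` come
  -- afterwards and can only add cost. On the right, the filtered lines of `t` miss and are skipped.
  cost-linesOf : ∀ t s → cost k t s ≤ cost k (sequential (linesOf t)) s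
  cost-linesOf stop          s = z≤n
  cost-linesOf (cutAt ℓ t u) s = +-monoʳ-≤ (alternations _ s) (+-mono-≤ onLeft onRight)
    where
    open ≤-Reasoning
    s₁ = below k ℓ s
    s₂ = above k ℓ s
    σ = filter (ℤ._≤? ℓ) (linesOf t)
    onLeft : cost k t s₁ ≤ cost k (sequential (σ ++ linesOf u)) s₁
    onLeft = begin
      cost k t s₁                            ≤⟨ cost-linesOf t s₁ ⟩
      cost k (sequential (linesOf t)) s₁     ≡⟨ cost-filter (ℤ._≤? ℓ) (linesOf t) (λ ℓ′≰ℓ →
        inj₁ (All.map (λ ≤ℓ → ℤ.≤-trans ≤ℓ (ℤ.<⇒≤ (ℤ.≰⇒> ℓ′≰ℓ))) (all-filter _ s))) ⟨
      cost k (sequential σ) s₁               ≤⟨ cost-prefix σ (linesOf u) s₁ ⟩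
      cost k (sequential (σ ++ linesOf u)) s₁ ∎
    onRight : cost k u s₂ ≤ cost k (sequential (σ ++ linesOf u)) s₂
    onRight = begin
      cost k u s₂                             ≤⟨ cost-linesOf u s₂ ⟩
      cost k (sequential (linesOf u)) s₂      ≡⟨ cost-skip {σ} (linesOf u) (All.map (λ ℓ′≤ℓ →
        inj₂ (All.map (ℤ.≤-<-trans ℓ′≤ℓ) (all-filter _ s))) (all-filter (ℤ._≤? ℓ) (linesOf t))) ⟨
      cost k (sequential (σ ++ linesOf u)) s₂ ∎

  -- Once `ℓ` has been cut, a repetition of `ℓ` misses both sides.
  cost-deduplicate : ∀ σ s →
    cost k (sequential (deduplicate ℤ._≟_ σ)) s ≡ cost k (sequential σ) s
  cost-deduplicate []      s = refl
  cost-deduplicate (ℓ ∷ σ) s = cong (alternations (isLeft k ℓ) s +_) (cong₂ _+_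
      (trans (cost-filter other? σ′ (λ ¬other → once ¬other (inj₁ (all-filter _ s))))
             (cost-deduplicate σ (below k ℓ s)))
      (trans (cost-filter other? σ′ (λ ¬other → once ¬other (inj₂ (all-filter _ s))))
             (cost-deduplicate σ (above k ℓ s))))
    where
    σ′ = deduplicate ℤ._≟_ σ
    other? = λ ℓ′ → ¬? (ℓ ℤ.≟ ℓ′)
    once : ∀ {ℓ′ s} → ¬ (ℓ ≢ ℓ′) → Misses ℓ s → Misses ℓ′ s
    once {ℓ′} ¬≢ m with ℓ ℤ.≟ ℓ′
    ... | yes refl = m
    ... | no  ℓ≢   = contradiction ℓ≢ ¬≢

  -- Deleting repetitions and lines outside `R` does not change the cost, and appending the absent
  -- lines of `R` does not lower it.
  cost-complete : ∀ {R s} → Unique R → (∀ {ℓ} → ℓ ∉ R → Misses ℓ s) → ∀ t →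
    ∃[ ρ ] (ρ ↭ R × cost k t s ≤ cost k (sequential ρ) s)
  cost-complete {R} {s} R! misses t = D ++ E , perm , (begin
      cost k t s                                   ≤⟨ cost-linesOf t s ⟩
      cost k (sequential (linesOf t)) s            ≡⟨ cost-filter (_∈? R) (linesOf t) misses ⟨
      cost k (sequential (filter (_∈? R) (linesOf t))) s ≡⟨ cost-deduplicate (filter (_∈? R) (linesOf t)) s ⟨
      cost k (sequential D) s                      ≤⟨ cost-prefix D E s ⟩
      cost k (sequential (D ++ E)) s               ∎)
    where
    open ≤-Reasoning
    D = deduplicate ℤ._≟_ (filter (_∈? R) (linesOf t))
    E = filter (_∉? D) R
    to : ∀ {ℓ} → ℓ ∈ D ++ E → ℓ ∈ R
    to ℓ∈ with ∈-++⁻ D ℓ∈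
    ... | inj₁ ℓ∈D = proj₂ (∈-filter⁻ (_∈? R) {xs = linesOf t} (∈-deduplicate⁻ ℤ._≟_ _ ℓ∈D))
    ... | inj₂ ℓ∈E = proj₁ (∈-filter⁻ (_∉? D) {xs = R} ℓ∈E)
    from : ∀ {ℓ} → ℓ ∈ R → ℓ ∈ D ++ E
    from {ℓ} ℓ∈R with ℓ ∈? D
    ... | yes ℓ∈D = ∈-++⁺ˡ ℓ∈D
    ... | no  ℓ∉D = ∈-++⁺ʳ D (∈-filter⁺ (_∉? D) ℓ∈R ℓ∉D)
    perm : D ++ E ↭ R
    perm = ∼bag⇒↭ (unique∧set⇒bag
      (Unique.++⁺ (deduplicate-! _) (Unique.filter⁺ (_∉? D) R!)
        (λ (ℓ∈D , ℓ∈E) → proj₂ (∈-filter⁻ (_∉? D) {xs = R} ℓ∈E) ℓ∈D))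
      R! (mk⇔ to from))

-- Row order of points in distinct rows

rowOrder = On.decTotalOrder ℤ.≤-decTotalOrder yc

open Sort rowOrder using (sort-↭; sort-↗)

DistinctRows : List Point → Set
DistinctRows Z = Unique (map yc Z)

Ascending : List Point → Set
Ascending = AllPairs (ℤ._<_ on yc)

ascending-head : ∀ {p q s t} → All (λ r → yc p ℤ.< yc r) s → All (λ r → yc q ℤ.< yc r) t →
  p ∈ q ∷ t → q ∈ p ∷ s → p ≡ q
ascending-head p< q< (here p≡q)  _           = p≡q
ascending-head p< q< (there p∈t) (here q≡p)  = sym q≡p
ascending-head p< q< (there p∈t) (there q∈s) =
  contradiction (All.lookup p< q∈s) (ℤ.<-asym (All.lookup q< p∈t))

-- Determines the result of sorting without unfolding the algorithm. Sorting thus commutes with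
-- filters and with maps that keep rows, as these preserve `Ascending`.
ascending-unique : ∀ {s t} → s ↭ t → Ascending s → Ascending t → s ≡ t
ascending-unique {[]}    {t}     s↭t _ _ = sym (Perm.↭-empty-inv (↭-sym s↭t))
ascending-unique {p ∷ s} {[]}    s↭t _ _ with () ← Perm.↭-empty-inv s↭t
ascending-unique {p ∷ s} {q ∷ t} s↭t (p< ∷ s↑) (q< ∷ t↑)
  with refl ← ascending-head p< q< (Perm.∈-resp-↭ s↭t (here refl)) (Perm.∈-resp-↭ (↭-sym s↭t) (here refl))
  = cong (p ∷_) (ascending-unique (Perm.drop-∷ s↭t) s↑ t↑)

sortByRow-↭ : ∀ Z → sortByRow Z ↭ Z
sortByRow-↭ = sort-↭

sortByRow-ascending : ∀ {Z} → DistinctRows Z → Ascending (sortByRow Z)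
sortByRow-ascending {Z} Z! = AllPairs.zipWith (λ (le , ne) → ℤ.≤∧≢⇒< le ne)
  ( Sorted⇒AllPairs (DecTotalOrder.totalOrder rowOrder) (sort-↗ Z)
  , AllPairs.map⁻ (PermS.Unique-resp-↭ (setoid ℤ)
      (↭⇒↭ₛ (Perm.map⁺ yc (↭-sym (sortByRow-↭ Z)))) Z!))

sortByRow-unique : ∀ {Z s} → DistinctRows Z → s ↭ Z → Ascending s → sortByRow Z ≡ s
sortByRow-unique Z! s↭Z s↑ =
  ascending-unique (↭-trans (sortByRow-↭ _) (↭-sym s↭Z)) (sortByRow-ascending Z!) s↑

distinctRows-filter : ∀ {P : Point → Set} (P? : Decidable P) {Z} →
  DistinctRows Z → DistinctRows (filter P? Z)
distinctRows-filter P? Z! = AllPairs.map⁺ (AllPairs.filter⁺ P? (AllPairs.map⁻ Z!))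

sortByRow-filter : ∀ {P : Point → Set} (P? : Decidable P) {Z} → DistinctRows Z →
  sortByRow (filter P? Z) ≡ filter P? (sortByRow Z)
sortByRow-filter P? {Z} Z! = sortByRow-unique (distinctRows-filter P? Z!)
  (Perm.filter-↭ P? (sortByRow-↭ Z)) (AllPairs.filter⁺ P? (sortByRow-ascending Z!))

module _ {f : Point → Point} (yc-f : ∀ p → yc (f p) ≡ yc p) where

  distinctRows-map : ∀ {Z} → DistinctRows Z → DistinctRows (map f Z)
  distinctRows-map Z! = AllPairs.map⁺ (AllPairs.map⁺
    (AllPairs.map (λ {p} {q} ne eq → ne (trans (sym (yc-f p)) (trans eq (yc-f q)))) (AllPairs.map⁻ Z!)))

  sortByRow-map : ∀ {Z} → DistinctRows Z → sortByRow (map f Z) ≡ map f (sortByRow Z)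
  sortByRow-map {Z} Z! = sortByRow-unique (distinctRows-map Z!)
    (Perm.map⁺ f (sortByRow-↭ Z))
    (AllPairs.map⁺ (AllPairs.map (λ {p} {q} → subst₂ ℤ._<_ (sym (yc-f p)) (sym (yc-f q)))
      (sortByRow-ascending Z!)))

module _ {A B : Set} (f : A → B) where

  alternationsFrom-map : ∀ c b s → alternationsFrom c b (map f s) ≡ alternationsFrom (c ∘ f) b s
  alternationsFrom-map c b []      = refl
  alternationsFrom-map c b (p ∷ s) = cong (_ +_) (alternationsFrom-map c (c (f p)) s)

  alternations-map : ∀ c s → alternations c (map f s) ≡ alternations (c ∘ f) s
  alternations-map c []      = refl
  alternations-map c (p ∷ s) = alternationsFrom-map c (c (f p)) s

  filter-map : ∀ {P : B → Set} (P? : Decidable P) s →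
    filter P? (map f s) ≡ map f (filter (P? ∘ f) s)
  filter-map P? []      = refl
  filter-map P? (p ∷ s) with does (P? (f p))
  ... | true  = cong (f p ∷_) (filter-map P? s)
  ... | false = filter-map P? s

  -- Turns costs in contracted columns into costs of the compressed instance.
  cost-map : ∀ k t s → cost k t (map f s) ≡ cost (k ∘ f) t s
  cost-map k stop          s = refl
  cost-map k (cutAt ℓ t u) s = cong₂ _+_ (alternations-map _ s) (cong₂ _+_
    (trans (cong (cost k t) (filter-map _ s)) (cost-map k t (below (k ∘ f) ℓ s)))
    (trans (cong (cost k u) (filter-map _ s)) (cost-map k u (above (k ∘ f) ℓ s))))

-- Charges of line orderings as costs of cut trees

crossings-alternations : ∀ ℓ s → crossings ℓ s ≡ alternations (leftOf ℓ) s
crossings-alternations ℓ []          = refl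
crossings-alternations ℓ (p ∷ [])    = refl
crossings-alternations ℓ (p ∷ q ∷ s) =
  cong (differ (leftOf ℓ p) (leftOf ℓ q) +_) (crossings-alternations ℓ (q ∷ s))

misses-strip : ∀ {S ℓ s} → All (InStrip S) s → ¬ StrictlyInside S ℓ → Misses xc ℓ s
misses-strip {S} {ℓ} inS outside with lo S ℤ.≤? ℓ
... | yes lo≤ = inj₁ (All.map (λ (_ , ≤hi) → ℤ.≤-trans ≤hi (ℤ.≮⇒≥ (λ <hi → outside (lo≤ , <hi)))) inS)
... | no  lo≰ = inj₂ (All.map (λ (lo≤ , _) → ℤ.<-≤-trans (ℤ.≰⇒> lo≰) lo≤) inS)

inStrip-∩ : ∀ Z S → All (InStrip S) (sortByRow (Z ∩ S))
inStrip-∩ Z S = Perm.All-resp-↭ (↭-sym (sortByRow-↭ (Z ∩ S))) (all-filter (inStrip? S) Z)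

module _ (Z : List Point) where

  totalCharge-++ : ∀ 𝓟 𝓠 σ →
    totalCharge Z (𝓟 ++ 𝓠) σ ≡ totalCharge Z 𝓟 σ + totalCharge Z 𝓠 σ
  totalCharge-++ 𝓟 𝓠 []      = refl
  totalCharge-++ 𝓟 𝓠 (ℓ ∷ σ)
    rewrite map-++ (chargeIn Z ℓ) 𝓟 𝓠 | sum-++ (map (chargeIn Z ℓ) 𝓟) (map (chargeIn Z ℓ) 𝓠)
          | concatMap-++ (cut ℓ) 𝓟 𝓠 | totalCharge-++ (concatMap (cut ℓ) 𝓟) (concatMap (cut ℓ) 𝓠) σ
    = regroup (charge Z ℓ 𝓟) (charge Z ℓ 𝓠) _ _
    where
    regroup : ∀ a b c d → a + b + (c + d) ≡ a + c + (b + d)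
    regroup = solve-∀

  chargeIn-inside : ∀ {ℓ S} → StrictlyInside S ℓ → chargeIn Z ℓ S ≡ crossings ℓ (sortByRow (Z ∩ S))
  chargeIn-inside {ℓ} {S} inside rewrite dec-true (strictlyInside? S ℓ) inside = refl

  chargeIn-outside : ∀ {ℓ S} → ¬ StrictlyInside S ℓ → chargeIn Z ℓ S ≡ 0
  chargeIn-outside {ℓ} {S} outside rewrite dec-false (strictlyInside? S ℓ) outside = refl

  cut-inside : ∀ {ℓ S} → StrictlyInside S ℓ → cut ℓ S ≡ leftPart S ℓ ∷ rightPart S ℓ ∷ []
  cut-inside {ℓ} {S} inside rewrite dec-true (strictlyInside? S ℓ) inside = refl

  cut-outside : ∀ {ℓ S} → ¬ StrictlyInside S ℓ → cut ℓ S ≡ [ S ]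
  cut-outside {ℓ} {S} outside rewrite dec-false (strictlyInside? S ℓ) outside = refl

filter-∘ : ∀ {A : Set} {P Q R : A → Set} (P? : Decidable P) (Q? : Decidable Q) (R? : Decidable R) →
  (∀ {p} → R p → P p × Q p) → (∀ {p} → P p → Q p → R p) → ∀ s →
  filter R? s ≡ filter P? (filter Q? s)
filter-∘ P? Q? R? to from [] = refl
filter-∘ P? Q? R? to from (p ∷ s) with R? p | Q? p
... | yes r | no ¬q = contradiction (proj₂ (to r)) ¬q
... | no ¬r | no ¬q = filter-∘ P? Q? R? to from s
... | yes r | yes q with P? p
...   | yes _ = cong (p ∷_) (filter-∘ P? Q? R? to from s)
...   | no ¬π = contradiction (proj₁ (to r)) ¬π
filter-∘ P? Q? R? to from (p ∷ s) | no ¬r | yes q with P? p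
...   | yes π = contradiction (from π q) ¬r
...   | no  _ = filter-∘ P? Q? R? to from s

module _ {Z : List Point} (Z! : DistinctRows Z) where

  -- Charges add over the strips of a partition, so the two parts of a cut strip evolve
  -- independently, as in a tree. A line outside `S` has no charge and misses the points of `S`.
  totalCharge-sequential : ∀ S σ →
    totalCharge Z [ S ] σ ≡ cost xc (sequential σ) (sortByRow (Z ∩ S))
  totalCharge-sequential S []      = refl
  totalCharge-sequential S (ℓ ∷ σ) with strictlyInside? S ℓ
  ... | no outside = begin
    totalCharge Z [ S ] (ℓ ∷ σ)
      ≡⟨ cong₂ (λ c 𝓟 → c + 0 + totalCharge Z (𝓟 ++ []) σ)
           (chargeIn-outside Z outside) (cut-outside Z outside) ⟩
    totalCharge Z [ S ] σ
      ≡⟨ totalCharge-sequential S σ ⟩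
    cost xc (sequential σ) (sortByRow (Z ∩ S))
      ≡⟨ cost-misses xc (sequential σ) (misses-strip (inStrip-∩ Z S) outside) ⟨
    cost xc (sequential (ℓ ∷ σ)) (sortByRow (Z ∩ S)) ∎
    where open ≡-Reasoning
  ... | yes inside@(lo≤ , <hi) = begin
    totalCharge Z [ S ] (ℓ ∷ σ)
      ≡⟨ cong₂ (λ c 𝓟 → c + 0 + totalCharge Z (𝓟 ++ []) σ)
           (chargeIn-inside Z inside) (cut-inside Z inside) ⟩
    crossings ℓ s + 0 + totalCharge Z ([ leftPart S ℓ ] ++ [ rightPart S ℓ ]) σ
      ≡⟨ cong₂ _+_ (trans (+-identityʳ _) (crossings-alternations ℓ s))
                   (totalCharge-++ Z [ leftPart S ℓ ] [ rightPart S ℓ ] σ) ⟩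
    alternations (leftOf ℓ) s + (totalCharge Z [ leftPart S ℓ ] σ + totalCharge Z [ rightPart S ℓ ] σ)
      ≡⟨ cong (alternations (leftOf ℓ) s +_) (cong₂ _+_
           (trans (totalCharge-sequential (leftPart S ℓ) σ) (cong (cost xc (sequential σ)) leftSide))
           (trans (totalCharge-sequential (rightPart S ℓ) σ) (cong (cost xc (sequential σ)) rightSide))) ⟩
    cost xc (sequential (ℓ ∷ σ)) s ∎
    where
    open ≡-Reasoning
    s = sortByRow (Z ∩ S)
    Z∩S! = distinctRows-filter (inStrip? S) Z!
    leftSide : sortByRow (Z ∩ leftPart S ℓ) ≡ below xc ℓ s
    leftSide = trans
      (cong sortByRow (filter-∘ (λ p → xc p ℤ.≤? ℓ) (inStrip? S) (inStrip? (leftPart S ℓ))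
        (λ (lo≤p , p≤ℓ) → p≤ℓ , lo≤p , ℤ.<⇒≤ (ℤ.≤-<-trans p≤ℓ <hi))
        (λ p≤ℓ (lo≤p , _) → lo≤p , p≤ℓ) Z))
      (sortByRow-filter _ Z∩S!)
    rightSide : sortByRow (Z ∩ rightPart S ℓ) ≡ above xc ℓ s
    rightSide = trans
      (cong sortByRow (filter-∘ (λ p → ℓ ℤ.<? xc p) (inStrip? S) (inStrip? (rightPart S ℓ))
        (λ (ℓ<p , p≤hi) → let ℓ<p = ℤ.suc[i]≤j⇒i<j ℓ<p in ℓ<p , ℤ.≤-trans lo≤ (ℤ.<⇒≤ ℓ<p) , p≤hi)
        (λ ℓ<p (_ , p≤hi) → ℤ.i<j⇒suc[i]≤j ℓ<p , p≤hi) Z))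
      (sortByRow-filter _ Z∩S!)

inBoundingBox : ∀ Z → All (InStrip (boundingBox Z)) Z
inBoundingBox []      = []
inBoundingBox (p ∷ Z) =
  (min≤⊤ (xc p) (map xc Z) , ⊥≤max (xc p) (map xc Z))
  ∷ All.zip (All.map⁻ (min≤xs (xc p) (map xc Z)) , All.map⁻ (xs≤max (xc p) (map xc Z)))

linesIn-complete : ∀ {S ℓ} → StrictlyInside S ℓ → ℓ ∈ linesIn S
linesIn-complete {S} {ℓ} (lo≤ℓ , ℓ<hi) =
  subst (_∈ linesIn S) offset (∈-applyUpTo⁺ (λ i → lo S ℤ.+ ℤ.+ i) small)
  where
  0≤ℓ-lo = ℤ.i≤j⇒0≤j-i lo≤ℓ
  0≤hi-lo = ℤ.i≤j⇒0≤j-i (ℤ.≤-trans lo≤ℓ (ℤ.<⇒≤ ℓ<hi))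
  small : ∣ ℓ ℤ.- lo S ∣ ℕ.< ∣ hi S ℤ.- lo S ∣
  small = ℤ.drop‿+<+ (subst₂ ℤ._<_ (sym (ℤ.0≤i⇒+∣i∣≡i 0≤ℓ-lo)) (sym (ℤ.0≤i⇒+∣i∣≡i 0≤hi-lo))
    (ℤ.+-monoˡ-< (ℤ.- lo S) ℓ<hi))
  offset : lo S ℤ.+ ℤ.+ ∣ ℓ ℤ.- lo S ∣ ≡ ℓ
  offset = begin
    lo S ℤ.+ ℤ.+ ∣ ℓ ℤ.- lo S ∣  ≡⟨ cong (λ i → lo S ℤ.+ i) (ℤ.0≤i⇒+∣i∣≡i 0≤ℓ-lo) ⟩
    lo S ℤ.+ (ℓ ℤ.- lo S)        ≡⟨ ℤ.+-comm (lo S) _ ⟩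
    ℓ ℤ.- lo S ℤ.+ lo S          ≡⟨ ℤ.+-assoc ℓ _ _ ⟩
    ℓ ℤ.+ (ℤ.- lo S ℤ.+ lo S)    ≡⟨ cong (λ i → ℓ ℤ.+ i) (ℤ.+-inverseˡ (lo S)) ⟩
    ℓ ℤ.+ ℤ.0ℤ                   ≡⟨ ℤ.+-identityʳ ℓ ⟩
    ℓ                            ∎
    where open ≡-Reasoning

linesIn-unique : ∀ S → Unique (linesIn S)
linesIn-unique S = Unique.applyUpTo⁺₁ _ ∣ hi S ℤ.- lo S ∣
  λ i<j _ eq → <⇒≢ i<j (ℤ.+-injective (∙-cancelˡ (lo S) _ _ eq))

module _ {Z : List Point} (Z! : DistinctRows Z) where

  WBσ-sequential : ∀ σ → WBσ σ Z ≡ cost xc (sequential σ) (sortByRow Z)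
  WBσ-sequential σ = trans (totalCharge-sequential Z! (boundingBox Z) σ)
    (cong (cost xc (sequential σ) ∘ sortByRow) (filter-all (inStrip? _) (inBoundingBox Z)))

  -- Lines outside `𝓛 Z` miss all of `Z`, so the tree can be turned into an ordering of `𝓛 Z`.
  -- Together with `WB≤`, this makes `WB Z` the maximal cost of a cut tree.
  cost≤WB : ∀ t → cost xc t (sortByRow Z) ≤ WB Z
  cost≤WB t with cost-complete xc (linesIn-unique (boundingBox Z)) misses t
    where
    misses : ∀ {ℓ} → ℓ ∉ 𝓛 Z → Misses xc ℓ (sortByRow Z)
    misses ℓ∉ = misses-strip {boundingBox Z}
      (Perm.All-resp-↭ (↭-sym (sortByRow-↭ Z)) (inBoundingBox Z)) (ℓ∉ ∘ linesIn-complete)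
  ... | ρ , ρ↭ , le = ℕ.v≤max⁺ 0 _ (inj₂ (Any.map
          (λ { refl → ≤-trans le (≤-reflexive (sym (WBσ-sequential ρ))) })
          (∈-map⁺ (λ σ → WBσ σ Z) (Equivalence.from ∈-permutations ρ↭))))

  WB≤ : ∀ {m} → (∀ t → cost xc t (sortByRow Z) ≤ m) → WB Z ≤ m
  WB≤ bound = ℕ.max≤v⁺ {xs = map (λ σ → WBσ σ Z) (permutations (𝓛 Z))} z≤n (All.map⁺ (All.universal
    (λ σ → ≤-trans (≤-reflexive (WBσ-sequential σ)) (bound (sequential σ))) _))

-- The strips of a partitioning tree

find-any : ∀ {A : Set} {P : A → Set} (P? : Decidable P) {xs} → Any P xs →
  ∃[ x ] (find P? xs ≡ just x × x ∈ xs × P x)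
find-any P? {x ∷ xs} any with P? x | any
... | yes Px | _         = x , refl , here refl , Px
... | no ¬Px | here Px   = contradiction Px ¬Px
... | no ¬Px | there any′ with find-any P? any′
...   | y , eq , y∈ , Py = y , eq , there y∈ , Py

module _ {X : List Point} where

  stripOf-⊆ : ∀ {S} {t : Tree X S} (v : Vertex t) {p} → InStrip (stripOf v) p → InStrip S p
  stripOf-⊆ root inV = inV
  stripOf-⊆ (left {in-S = _ , ℓ<hi} v) {p} inV with stripOf-⊆ v {p} inV
  ... | lo≤ , ≤ℓ = lo≤ , ℤ.<⇒≤ (ℤ.≤-<-trans ≤ℓ ℓ<hi)
  stripOf-⊆ (right {in-S = lo≤ℓ , _} v) {p} inV with stripOf-⊆ v {p} inV
  ... | ℓ< , ≤hi = ℤ.≤-trans lo≤ℓ (ℤ.<⇒≤ (ℤ.suc[i]≤j⇒i<j ℓ<)) , ≤hi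

  -- The search path of the column of the point. For a point of `S` its vertices are those whose
  -- strips contain the point, which translates `MeetsEveryPathOnce` into a statement about points.
  pathTo : ∀ {S} → Point → (t : Tree X S) → Path t
  pathTo p (leaf _) = end
  pathTo p (node ℓ _ _ l r) with xc p ℤ.≤? ℓ
  ... | yes _ = left (pathTo p l)
  ... | no  _ = right (pathTo p r)

  on-pathTo⇒inStrip : ∀ {S p} (t : Tree X S) {v : Vertex t} →
    InStrip S p → v On pathTo p t → InStrip (stripOf v) p
  on-pathTo⇒inStrip t {root} inS _ = inS
  on-pathTo⇒inStrip {p = p} (node ℓ _ _ l r) {left v} (lo≤ , _) on with xc p ℤ.≤? ℓ | on
  ... | yes ≤ℓ | left on′ = on-pathTo⇒inStrip l (lo≤ , ≤ℓ) on′
  on-pathTo⇒inStrip {p = p} (node ℓ _ _ l r) {right v} (_ , ≤hi) on with xc p ℤ.≤? ℓ | on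
  ... | no ≰ℓ | right on′ = on-pathTo⇒inStrip r (ℤ.i<j⇒suc[i]≤j (ℤ.≰⇒> ≰ℓ) , ≤hi) on′

  inStrip⇒on-pathTo : ∀ {S p} (t : Tree X S) (v : Vertex t) →
    InStrip (stripOf v) p → v On pathTo p t
  inStrip⇒on-pathTo t root _ = root
  inStrip⇒on-pathTo {p = p} (node ℓ _ _ l r) (left v) inV with xc p ℤ.≤? ℓ
  ... | yes _  = left (inStrip⇒on-pathTo l v inV)
  ... | no  ≰ℓ = contradiction (proj₂ (stripOf-⊆ v {p} inV)) ≰ℓ
  inStrip⇒on-pathTo {p = p} (node ℓ _ _ l r) (right v) inV with xc p ℤ.≤? ℓ
  ... | yes ≤ℓ = contradiction ≤ℓ (ℤ.<⇒≱ (ℤ.suc[i]≤j⇒i<j (proj₁ (stripOf-⊆ v {p} inV))))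
  ... | no  _  = right (inStrip⇒on-pathTo r v inV)

  yc-compressPoint : ∀ {S} {t : Tree X S} (U : List (Vertex t)) p →
    yc (compressPoint U p) ≡ yc p
  yc-compressPoint U p with find (λ v → inStrip? (stripOf v) p) U
  ... | just _  = refl
  ... | nothing = refl

-- The least column is attained in `Z`; the point `p` excludes the dummy box of the empty list.
leftmost-inStrip : ∀ {S Z p y} → All (InStrip S) Z → p ∈ Z → InStrip S (lo (boundingBox Z) , y)
leftmost-inStrip {S} {q ∷ Z} (inS ∷ all) _ =
  argmin-all id {P = λ z → lo S ℤ.≤ z × z ℤ.≤ hi S} inS (All.map⁺ all)

-- Intervals that occur in both orders overlap: `q` is common to them if it is not right of `p′`,
-- and otherwise `p′` is.
strips-meet : ∀ {I J p p′ q q′} → InStrip I p → InStrip I p′ → InStrip J q → InStrip J q′ →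
  xc p ℤ.≤ xc q → xc q′ ℤ.< xc p′ → ∃[ r ] (InStrip I r × InStrip J r)
strips-meet {p = p} {p′} {q} {q′} p∈I p′∈I q∈J q′∈J p≤q q′<p′ with xc q ℤ.≤? xc p′
... | yes q≤p′ = q , (ℤ.≤-trans (proj₁ p∈I) p≤q , ℤ.≤-trans q≤p′ (proj₂ p′∈I)) , q∈J
... | no  q≰p′ = p′ , p′∈I ,
  (ℤ.≤-trans (proj₁ q′∈J) (ℤ.<⇒≤ q′<p′) , ℤ.≤-trans (ℤ.<⇒≤ (ℤ.≰⇒> q≰p′)) (proj₂ q∈J))

-- The split at `U`

module _ {X : List Point} (T : PartitioningTree X)
  (U : List (Vertex T)) (once : MeetsEveryPathOnce U) where

  compressedColumn : Point → ℤ
  compressedColumn p = xc (compressPoint U p)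

  -- Both vertices lie on the search path of `r`, which meets `U` once.
  disjoint : ∀ {v v′ r} → v ∈ U → v′ ∈ U →
    InStrip (stripOf v) r → InStrip (stripOf v′) r → v ≡ v′
  disjoint {v} {v′} {r} v∈ v′∈ r∈v r∈v′ with once (pathTo r T)
  ... | _ , _ , unique = trans
    (sym (unique (v∈ , inStrip⇒on-pathTo T v r∈v)))
    (unique (v′∈ , inStrip⇒on-pathTo T v′ r∈v′))

  -- The search path of `p` meets `U`, so `find` succeeds. The compressed point stays in the strip,
  -- which allows the strip to be recovered from the compressed column.
  locate : ∀ {p} → p ∈ X → ∃[ v ] (v ∈ U × InStrip (stripOf v) p
    × InStrip (stripOf v) (compressPoint U p) × compressedColumn p ≡ leftmostColumn v)
  locate {p} p∈X with once (pathTo p T)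
  ... | w , (w∈ , on) , _
    with find-any (λ v → inStrip? (stripOf v) p)
           (lose w∈ (on-pathTo⇒inStrip T (All.lookup (inBoundingBox X) p∈X) on))
  ... | v , found , v∈ , p∈v rewrite found = v , v∈ , p∈v ,
    leftmost-inStrip {y = yc p} (all-filter (inStrip? (stripOf v)) X)
      (∈-filter⁺ (inStrip? (stripOf v)) p∈X p∈v) ,
    refl

  -- If compression reversed the order, the two strips would meet, hence coincide, and the
  -- compressed columns would be equal.
  compressedColumn-mono : ∀ {p q} → p ∈ X → q ∈ X →
    xc p ℤ.≤ xc q → compressedColumn p ℤ.≤ compressedColumn q
  compressedColumn-mono {p} {q} p∈X q∈X p≤q
    with compressedColumn p ℤ.≤? compressedColumn q | locate p∈X | locate q∈X
  ... | yes le | _ | _ = le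
  ... | no  ≰  | v , v∈ , p∈v , p′∈v , eq | v′ , v′∈ , q∈v′ , q′∈v′ , eq′
    with strips-meet {stripOf v} {stripOf v′} {p} {compressPoint U p} {q} {compressPoint U q}
           p∈v p′∈v q∈v′ q′∈v′ p≤q (ℤ.≰⇒> ≰)
  ... | r , r∈v , r∈v′ = ℤ.≤-reflexive
    (trans eq (trans (cong leftmostColumn (disjoint {r = r} v∈ v′∈ r∈v r∈v′)) (sym eq′)))

  -- Equal compressed columns give a point common to both strips, so the strips belong to the same
  -- vertex.
  block-inStrip : ∀ {p} → p ∈ X →
    ∃[ v ] (v ∈ U × (∀ {q} → q ∈ X → compressedColumn q ≡ compressedColumn p → InStrip (stripOf v) q))
  block-inStrip p∈X with locate p∈X
  ... | v , v∈ , p∈v , p′∈v , _ = v , v∈ , λ {q} q∈X same → inV q∈X same (locate q∈X)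
    where
    inV : ∀ {q} → q ∈ X → compressedColumn q ≡ _ → _ → InStrip (stripOf v) q
    inV {q} _ same (v′ , v′∈ , q∈v′ , q′∈v′ , _) =
      subst (λ w → InStrip (stripOf w) q)
        (disjoint {r = compressPoint U q} v′∈ v∈ q′∈v′
          (subst (λ z → lo (stripOf v) ℤ.≤ z × z ℤ.≤ hi (stripOf v)) (sym same) p′∈v))
        q∈v′

  compressPoint-inBox : ∀ {p} → p ∈ X → InStrip (boundingBox X) (compressPoint U p)
  compressPoint-inBox {p} p∈X with locate p∈X
  ... | v , _ , _ , p′∈v , _ = stripOf-⊆ v {compressPoint U p} p′∈v

  module _ (X! : DistinctRows X) where
    private
      s : List Point
      s = sortByRow X
      s⇒X : ∀ {p} → p ∈ s → p ∈ X
      s⇒X = Perm.∈-resp-↭ (sortByRow-↭ X)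
      mono : ∀ {p q} → p ∈ s → q ∈ s → xc p ℤ.≤ xc q → compressedColumn p ℤ.≤ compressedColumn q
      mono p∈ q∈ = compressedColumn-mono (s⇒X p∈) (s⇒X q∈)
      covered : ∀ {p} → p ∈ s → ∃[ v ] (v ∈ U ×
        (∀ {q} → q ∈ s → compressedColumn q ≡ compressedColumn p → InStrip (stripOf v) q))
      covered p∈ with block-inStrip (s⇒X p∈)
      ... | v , v∈ , inV = v , v∈ , inV ∘ s⇒X

    open Contraction xc compressedColumn U (inStrip? ∘ stripOf) s mono covered

    -- Each part costs at most as much as its tree on all of `s`, hence at most one Wilber bound of
    -- the compressed instance.
    total≤ : ∀ D a b → total D a b s ≤ 4 * WB (compressed U)
    total≤ D a b = ≤-trans
      (+-mono-≤ (+-mono-≤ (part≤ _ _) (part≤ _ _)) (+-mono-≤ (part≤ _ _) (part≤ _ _)))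
      (≤-reflexive (four (WB (compressed U))))
      where
      four : ∀ n → n + n + (n + n) ≡ 4 * n
      four = solve-∀
      yc-same = yc-compressPoint U
      part≤ : ∀ i j → part D a b s i j ≤ WB (compressed U)
      part≤ i j = begin
        part D a b s i j
          ≤⟨ cost-mono compressedColumn (D i j) (filter-⊆ _ s) ⟩
        cost compressedColumn (D i j) s
          ≡⟨ cost-map (compressPoint U) xc (D i j) s ⟨
        cost xc (D i j) (map (compressPoint U) s)
          ≡⟨ cong (cost xc (D i j)) (sortByRow-map yc-same X!) ⟨
        cost xc (D i j) (sortByRow (compressed U))
          ≤⟨ cost≤WB (distinctRows-map yc-same X!) (D i j) ⟩
        WB (compressed U)           ∎
        where open ≤-Reasoning

    blockCost≤ : ∀ f → blockCost f s ≤ sum (map (λ v → WB (splitInstance v)) U)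
    blockCost≤ f = weight-mono (λ v → ≤-trans
      (≤-reflexive (cong (cost xc (f v)) (sym (sortByRow-filter (inStrip? (stripOf v)) X!))))
      (cost≤WB (distinctRows-filter (inStrip? (stripOf v)) X!) (f v))) U

    weight-potential≤ : ∀ a b s → weight (potential a b) s ≤ 4 * length s
    weight-potential≤ a b []      = z≤n
    weight-potential≤ a b (p ∷ s) = ≤-trans
      (+-mono-≤ (+-monoʳ-≤ 2 (toll≤2 (inside? a b) p)) (weight-potential≤ a b s))
      (≤-reflexive (sym (*-suc 4 (length s))))

    WB-split :
      WB X ≤ 4 * WB (compressed U)
             + 8 * sum (map (λ v → WB (splitInstance v)) U)
             + 4 * length X
    WB-split = WB≤ X! λ t → summands (bounded t ⊆-refl (All.tabulate (compressPoint-inBox ∘ s⇒X)))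
      where
      -- Compressed points stay in the bounding box, so its sides serve as the initial end columns.
      a = lo (boundingBox X)
      b = hi (boundingBox X)
      summands : ∀ {t} → Bounded t a b s →
        cost xc t s ≤ 4 * WB (compressed U)
                      + 8 * sum (map (λ v → WB (splitInstance v)) U)
                      + 4 * length X
      summands record { D = D ; f = f ; bound = bound } = ≤-trans bound (+-mono-≤
        (+-mono-≤ (total≤ D a b) (≤-trans (blockCost≤ f) (m≤n*m _ 8)))
        (≤-trans (weight-potential≤ a b s)
                 (≤-reflexive (cong (4 *_) (Perm.↭-length (sortByRow-↭ X))))))

sameRow⇒≡ : ∀ {X} → IsSemiPermutation X → ∀ {p q} → p ∈ X → q ∈ X → yc p ≡ yc q → p ≡ q
sameRow⇒≡ semi {p} {q} p∈X q∈X eq with semi (yc q) (q , q∈X , refl)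
... | _ , _ , unique = trans (sym (unique (p∈X , eq))) (unique (q∈X , refl))

unique-map : ∀ {A B : Set} {f : A → B} {s} →
  (∀ {p q} → p ∈ s → q ∈ s → f p ≡ f q → p ≡ q) → Unique s → Unique (map f s)
unique-map inj []        = []
unique-map inj (p≢ ∷ s!) =
  All.map⁺ (All.tabulate λ q∈ eq → All.lookup p≢ q∈ (inj (here refl) (there q∈) eq))
  ∷ unique-map (λ p∈ q∈ → inj (there p∈) (there q∈)) s!

theorem3p4 : ∃[ c ] ((X : List Point) → Unique X → IsSemiPermutation X →
    (T : PartitioningTree X) →
    (U : List (Vertex T)) → Unique U → MeetsEveryPathOnce U →
    WB X ≤ 4 * WB (compressed U)
    + 8 * sum (map (λ v → WB (splitInstance v)) U)
    + c * length X)
-- The constant is the largest potential of a point, 2 + 2.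
theorem3p4 = 4 , λ X X! semi T U _ once →
  WB-split T U once (unique-map (sameRow⇒≡ semi) X!)
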